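{- For all integers $n\ge 0$ and $\alpha\ge 1$, \[\overline{p}_3(7^4 n)\equiv \overline{p}_3(7^2 n)\pmod 7,\] and \[\overline{p}_3\big(7^{2\alpha+1}(7n+3)\big)\equiv \overline{p}_3\big(7^{2\alpha+1}(7n+5)\big)\equiv \overline{p}_3\big(7^{2\alpha+1}(7n+6)\big)\equiv 0\pmod 7.\]
   Context: An overpartition of $n$ is a partition of $n$ in which the first occurrence of each distinct part may (or may not) be overlined. An overpartition triple of $n$ is a triple of overpartitions whose parts together sum to $n$. $\overline{p}_3(n)$ denotes the number of overpartition triples of $n$, with $\overline{p}_3(0)=1$; equivalently $\sum_{n\ge0}\overline{p}_3(n)q^n=\big((-q;q)_\infty/(q;q)_\infty\big)^3$, where $(a;q)_\infty=\prod_{n\ge0}(1-aq^n)$. -}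

module Defs where

open import Data.Nat using (ℕ; zero; suc; _+_; _*_; _∸_; _≤?_)
open import Relation.Nullary.Decidable using (does)
open import Data.Bool using (if_then_else_)

sum1to : ℕ → (ℕ → ℕ) → ℕ
sum1to zero    f = 0
sum1to (suc N) f = sum1to N f + f (suc N)

sum0to : ℕ → (ℕ → ℕ) → ℕ
sum0to zero    f = f 0
sum0to (suc N) f = sum0to N f + f (suc N)

-- ovParts k n : number of overpartitions of n all of whose parts are ≤ k.
-- A part size j occurring with multiplicity m ≥ 1 contributes 2 choices
-- (first occurrence overlined or not).
ovParts : ℕ → ℕ → ℕ
ovParts zero    zero    = 1
ovParts zero    (suc n) = 0
ovParts (suc k) n =
  ovParts k n +
  2 * sum1to n (λ m → if does (m * suc k ≤? n)
                        then ovParts k (n ∸ m * suc k)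
                        else 0)

pbar : ℕ → ℕ
pbar n = ovParts n n

pbar3 : ℕ → ℕ
pbar3 n = sum0to n (λ i → sum0to (n ∸ i) (λ j → pbar i * pbar j * pbar (n ∸ i ∸ j)))

{-# OPTIONS --safe #-}

-- Write φ(q) = Σ q^(a²). By Gauss's identity the generating function of pbar is 1/φ(-q), and
-- φ(-q)⁷ ≡ φ(-q⁷) mod 7, so Σ pbar3(n) qⁿ = 1/φ(-q)³ ≡ φ(-q)⁴/φ(-q⁷). Extracting the exponents
-- divisible by 7 and using r₄(7n) ≡ r₄(n) gives Σ pbar3(7n) qⁿ ≡ φ(-q)³, that is,
-- pbar3(7n) ≡ (-1)ⁿ r₃(n) mod 7. Both claims then follow from the congruence
-- r₃(49n) ≡ (1 - (-n/7)) r₃(n).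
--
-- The congruences for r₄ and r₃ come from the eight quaternions α = 2 ± i ± j ± k of norm 7. If 7 divides
-- the norm of v, the number of α with v = α w for an integral w is 8 or 1 according as 7 divides v or not;
-- summing over v gives 8 r₄(n) ≡ r₄(7n). For r₃ one counts in the same way the α with v = α w ᾱ, where v
-- and w are pure. If v is not divisible by 7 there is exactly one; if v = 7u, the count is the number of α
-- whose line modulo 7 is fixed by u, which is 1 + (-n/7) modulo 7, where n is the norm of u.

module Submission where

open import Defs

-- The counts reflect a picture modulo 7, where the quaternions become the 2 × 2 matrices over F₇
-- and ᾱ the adjugate of α. An α of norm 7 has rank one there, the kernel of ᾱ is the image of α,
-- and the images of the eight α are the eight lines of F₇². Since ᾱα = 7, v = α w means 7 ∣ ᾱv, and
-- v = α w ᾱ means 49 ∣ ᾱvα. The first condition depends only on v modulo 7, so its count is settled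
-- by evaluation on all residues. The second does not, and this is the obstacle: for v = 7u a factor
-- 7 cancels, while for other v the condition must be lifted from 7 to 49 by means of 49 ∣ v·v. The
-- series side avoids limits and subtraction. Coefficients are natural numbers compared modulo 7,
-- with 6 for -1; series are truncated, so q is nilpotent and 1 - qᵏ can be cancelled;
-- representations by squares are counted in finite boxes that contain them all.

module CharacteristicSeven where

  open import Algebra using (CommutativeSemiring; RawRing)
  import Algebra.Properties.CommutativeSemiring.Exp as CExp
  import Algebra.Properties.Semiring.Exp as Exp
  import Algebra.Properties.Semiring.Mult.TCOptimised as Mult
  import Algebra.Solver.Ring as RingSolver
  open import Algebra.Solver.Ring.AlmostCommutativeRing
  open import Data.Integer as ℤ using (ℤ; ∣_∣; +_; -[1+_])
  open import Data.List using (List; []; _∷_; _++_; map; cartesianProduct)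
  open import Data.Maybe using (Maybe; just; nothing)
  open import Data.Nat as ℕ using (ℕ; zero; suc)
  import Data.Nat.DivMod as ℕ
  import Data.Nat.Properties as ℕ
  open import Data.Product using (_×_; _,_)
  open import Relation.Binary.PropositionalEquality as ≡ using (_≡_)
  import Relation.Binary.Reasoning.Setoid as SetoidReasoning
  open import Relation.Nullary using (yes; no)

  interval : ℕ → List ℤ
  interval zero = ℤ.0ℤ ∷ []
  interval (suc n) = + suc n ∷ -[1+ n ] ∷ interval n

  -- Commutative semirings of characteristic 7, and Gauss's identity in them.

  HasCharacteristic7 : ∀ {c ℓ} → CommutativeSemiring c ℓ → Set ℓ
  HasCharacteristic7 R = 7 · 1# ≈ 0#
    where
    open CommutativeSemiring R
    open Mult semiring renaming (_×_ to _·_)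

  module Characteristic7 {c ℓ} (R : CommutativeSemiring c ℓ) (7×1≈0 : HasCharacteristic7 R) where

    open CommutativeSemiring R
    open Exp semiring using (_^_; ^-homo-*; ^-congˡ; ^-assocʳ)
    open CExp R using (^-distrib-*)
    open Mult semiring using (×-homo-+; ×1-homo-*) renaming (_×_ to _·_)
    open SetoidReasoning setoid

    -- Reducing the coefficients modulo 7 makes the solver decide identities in characteristic 7.
    private
      ℤ/7 : RawRing _ _
      ℤ/7 = record
        { Carrier = ℕ
        ; _≈_ = _≡_
        ; _+_ = λ m n → (m ℕ.+ n) ℕ.% 7
        ; _*_ = λ m n → (m ℕ.* n) ℕ.% 7
        -- `fromCommutativeSemiring` interprets negation as the identity, so the coefficients must
        -- do the same; genuine signs are written with `-1#`.
        ; -_ = λ n → n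
        ; 0# = 0
        ; 1# = 1
        }

      %7-·1 : ∀ n → (n ℕ.% 7) · 1# ≈ n · 1#
      %7-·1 n = sym (begin
        n · 1#
          ≡⟨ ≡.cong (_· 1#) (ℕ.m≡m%n+[m/n]*n n 7) ⟩
        (n ℕ.% 7 ℕ.+ n ℕ./ 7 ℕ.* 7) · 1#
          ≈⟨ ×-homo-+ 1# (n ℕ.% 7) _ ⟩
        (n ℕ.% 7) · 1# + (n ℕ./ 7 ℕ.* 7) · 1#
          ≈⟨ +-congˡ (×1-homo-* (n ℕ./ 7) 7) ⟩
        (n ℕ.% 7) · 1# + (n ℕ./ 7) · 1# * 7 · 1#
          ≈⟨ +-congˡ (trans (*-congˡ 7×1≈0) (zeroʳ _)) ⟩
        (n ℕ.% 7) · 1# + 0#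
          ≈⟨ +-identityʳ _ ⟩
        (n ℕ.% 7) · 1# ∎)

      homomorphism : ℤ/7 -Raw-AlmostCommutative⟶ fromCommutativeSemiring R
      homomorphism = record
        { ⟦_⟧ = _· 1#
        ; +-homo = λ m n → trans (%7-·1 (m ℕ.+ n)) (×-homo-+ 1# m n)
        ; *-homo = λ m n → trans (%7-·1 (m ℕ.* n)) (×1-homo-* m n)
        ; -‿homo = λ _ → refl
        ; 0-homo = refl
        ; 1-homo = refl
        }

      equal? : ∀ m n → Maybe (m · 1# ≈ n · 1#)
      equal? m n with m ℕ.≟ n
      ... | yes ≡.refl = just refl
      ... | no _ = nothing

    module Solver = RingSolver ℤ/7 (fromCommutativeSemiring R) homomorphism equal?
    open Solver using (solve; con; _:+_; _:*_; _:^_; _:=_)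

    -- The middle binomial coefficients 7, 21 and 35 become 0 in the coefficient ring of the solver.
    frobenius-+ : ∀ a b → (a + b) ^ 7 ≈ a ^ 7 + b ^ 7
    frobenius-+ = solve 2 (λ a b → (a :+ b) :^ 7 := a :^ 7 :+ b :^ 7) refl

    module _ {a} {A : Set a} where

      sum : List A → (A → Carrier) → Carrier
      sum [] f = 0#
      sum (a ∷ as) f = f a + sum as f

      sum-cong : ∀ as {f g} → (∀ a → f a ≈ g a) → sum as f ≈ sum as g
      sum-cong [] f≈g = refl
      sum-cong (a ∷ as) f≈g = +-cong (f≈g a) (sum-cong as f≈g)

      frobenius-sum : ∀ as f → sum as f ^ 7 ≈ sum as (λ a → f a ^ 7)
      frobenius-sum [] f = solve 0 (con 0 :^ 7 := con 0) refl
      frobenius-sum (a ∷ as) f =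
        trans (frobenius-+ (f a) (sum as f)) (+-congˡ (frobenius-sum as f))

      sum-*ˡ : ∀ as f b → b * sum as f ≈ sum as (λ a → b * f a)
      sum-*ˡ [] f b = zeroʳ b
      sum-*ˡ (a ∷ as) f b = trans (distribˡ b _ _) (+-congˡ (sum-*ˡ as f b))

      sum-++ : ∀ as bs f → sum (as ++ bs) f ≈ sum as f + sum bs f
      sum-++ [] bs f = sym (+-identityˡ _)
      sum-++ (a ∷ as) bs f = trans (+-congˡ (sum-++ as bs f)) (sym (+-assoc _ _ _))

    sum-map : ∀ {a b} {A : Set a} {B : Set b} (h : A → B) as f →
              sum (map h as) f ≈ sum as (λ a → f (h a))
    sum-map h [] f = refl
    sum-map h (a ∷ as) f = +-congˡ (sum-map h as f)

    sum-cartesianProduct : ∀ {a b} {A : Set a} {B : Set b} (as : List A) (bs : List B) f g →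
      sum (cartesianProduct as bs) (λ (a , b) → f a * g b) ≈ sum as f * sum bs g
    sum-cartesianProduct [] bs f g = sym (zeroˡ _)
    sum-cartesianProduct (a ∷ as) bs f g = begin
      sum (map (a ,_) bs ++ cartesianProduct as bs) fg
        ≈⟨ sum-++ (map (a ,_) bs) _ fg ⟩
      sum (map (a ,_) bs) fg + sum (cartesianProduct as bs) fg
        ≈⟨ +-cong (sum-map (a ,_) bs fg) (sum-cartesianProduct as bs f g) ⟩
      sum bs (λ b → f a * g b) + sum as f * sum bs g
        ≈⟨ +-congʳ (sum-*ˡ bs g (f a)) ⟨
      f a * sum bs g + sum as f * sum bs g
        ≈⟨ distribʳ _ _ _ ⟨
      (f a + sum as f) * sum bs g ∎
      where fg = λ (a , b) → f a * g b

    -- The number 6 = 2 · 3, which is -1 because 1 + 6 = 7 vanishes; a semiring offers no negation.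
    -1# : Carrier
    -1# = (1# + 1#) * (1# + 1# + 1#)

    private
      :-1 : ∀ {n} → Solver.Polynomial n
      :-1 = (con 1 :+ con 1) :* (con 1 :+ con 1 :+ con 1)

    -1^[1+n]*n≈1 : ∀ n → -1# ^ (suc n ℕ.* n) ≈ 1#
    -1^[1+n]*n≈1 zero = refl
    -1^[1+n]*n≈1 (suc n) = begin
      -1# ^ (suc (suc n) ℕ.* suc n)
        ≡⟨ ≡.cong (-1# ^_) (≡.trans (ℕ.*-distribʳ-+ (suc n) 2 n) (≡.cong₂ ℕ._+_ (ℕ.*-comm 2 (suc n)) (ℕ.*-comm n (suc n)))) ⟩
      -1# ^ (suc n ℕ.* 2 ℕ.+ suc n ℕ.* n)
        ≈⟨ ^-homo-* -1# (suc n ℕ.* 2) (suc n ℕ.* n) ⟩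
      -1# ^ (suc n ℕ.* 2) * -1# ^ (suc n ℕ.* n)
        ≈⟨ *-cong (even (suc n)) (-1^[1+n]*n≈1 n) ⟩
      1# * 1# ≈⟨ *-identityˡ 1# ⟩
      1# ∎
      where
      even : ∀ n → -1# ^ (n ℕ.* 2) ≈ 1#
      even zero = refl
      even (suc n) = trans (solve 1 (λ p → :-1 :* (:-1 :* p) := p) refl (-1# ^ (n ℕ.* 2))) (even n)

    -- n² and n have the same parity, as n (n + 1) is even. This turns the terms (-1)ᵏ q^(k²) of the
    -- theta series into powers (-q)^(k²), whose sign is a function of the exponent alone.
    -1^n*n≈-1^n : ∀ n → -1# ^ (n ℕ.* n) ≈ -1# ^ n
    -1^n*n≈-1^n n = begin
      -1# ^ (n ℕ.* n)
        ≈⟨ *-identityˡ _ ⟨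
      1# * -1# ^ (n ℕ.* n)
        ≈⟨ *-congʳ (square (-1# ^ n) n refl) ⟨
      -1# ^ n * -1# ^ n * -1# ^ (n ℕ.* n)
        ≈⟨ *-assoc _ _ _ ⟩
      -1# ^ n * (-1# ^ n * -1# ^ (n ℕ.* n))
        ≈⟨ *-congˡ (^-homo-* -1# n (n ℕ.* n)) ⟨
      -1# ^ n * -1# ^ (suc n ℕ.* n)
        ≈⟨ *-congˡ (-1^[1+n]*n≈1 n) ⟩
      -1# ^ n * 1#
        ≈⟨ *-identityʳ _ ⟩
      -1# ^ n ∎
      where
      square : ∀ p n → p ≈ -1# ^ n → p * p ≈ 1#
      square p zero p≈ = trans (*-cong p≈ p≈) (*-identityˡ 1#)
      square p (suc n) p≈ = begin
        p * p ≈⟨ *-cong p≈ p≈ ⟩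
        (-1# * -1# ^ n) * (-1# * -1# ^ n)
          ≈⟨ solve 1 (λ p → (:-1 :* p) :* (:-1 :* p) := p :* p) refl (-1# ^ n) ⟩
        -1# ^ n * -1# ^ n ≈⟨ square (-1# ^ n) n refl ⟩
        1# ∎

    [-1*a]^n≈0 : ∀ {a} n → a ^ n ≈ 0# → (-1# * a) ^ n ≈ 0#
    [-1*a]^n≈0 {a} n a^n≈0 =
      trans (^-distrib-* -1# a n) (trans (*-congˡ a^n≈0) (zeroʳ _))

    -- The finite geometric series in -u inverts 1 + u as soon as uⁿ = 0. For truncated series this
    -- replaces division by 1 - qᵏ.
    1+nilpotent-cancelˡ : ∀ {u f g} n → u ^ n ≈ 0# →
                          (1# + u) * f ≈ (1# + u) * g → f ≈ g
    1+nilpotent-cancelˡ {u} {f} {g} n u^n≈0 eq = begin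
      f ≈⟨ expand f ⟩
      geometric n * ((1# + u) * f) ≈⟨ *-congˡ eq ⟩
      geometric n * ((1# + u) * g) ≈⟨ expand g ⟨
      g ∎
      where
      geometric : ℕ → Carrier
      geometric zero = 0#
      geometric (suc m) = geometric m + (-1# * u) ^ m

      telescope : ∀ m → geometric m * (1# + u) + (-1# * u) ^ m ≈ 1#
      telescope zero = trans (+-congʳ (zeroˡ _)) (+-identityˡ 1#)
      telescope (suc m) = trans
        (solve 3 (λ s p u → (s :+ p) :* (con 1 :+ u) :+ :-1 :* u :* p := s :* (con 1 :+ u) :+ p)
          refl (geometric m) ((-1# * u) ^ m) u)
        (telescope m)

      inverse : geometric n * (1# + u) ≈ 1#
      inverse = trans (sym (trans (+-congˡ ([-1*a]^n≈0 n u^n≈0)) (+-identityʳ _))) (telescope n)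

      expand : ∀ h → h ≈ geometric n * ((1# + u) * h)
      expand h = trans (sym (*-identityˡ h)) (trans (*-congʳ (sym inverse)) (*-assoc _ _ _))

    -- Used with a the overpartition series and b = φ(-q) its inverse: multiplying a³ by the seventh
    -- power b⁷ leaves the polynomial expression b⁴ in theta.
    [ab]³b⁴≈b⁴ : ∀ {a b} → a * b ≈ 1# → a * (a * a) * b ^ 7 ≈ b * (b * (b * b))
    [ab]³b⁴≈b⁴ {a} {b} ab≈1 = begin
      a * (a * a) * b ^ 7
        ≈⟨ solve 2 (λ a b → a :* (a :* a) :* b :^ 7 := (a :* b) :^ 3 :* (b :* (b :* (b :* b)))) refl a b ⟩
      (a * b) ^ 3 * (b * (b * (b * b)))
        ≈⟨ *-congʳ (^-congˡ 3 ab≈1) ⟩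
      1# ^ 3 * (b * (b * (b * b)))
        ≈⟨ solve 1 (λ b → con 1 :^ 3 :* b := b) refl _ ⟩
      b * (b * (b * b)) ∎

    -- Removes the factor b = φ(-q) that remains once the exponents divisible by 7 have been
    -- extracted; c is then the series of the pbar3(7n).
    cb≈b⁴⇒c≈b³ : ∀ {a b c} → a * b ≈ 1# → c * b ≈ b * (b * (b * b)) → c ≈ b * (b * b)
    cb≈b⁴⇒c≈b³ {a} {b} {c} ab≈1 cb≈b⁴ = begin
      c ≈⟨ *-identityʳ c ⟨
      c * 1# ≈⟨ *-congˡ ab≈1 ⟨
      c * (a * b) ≈⟨ solve 3 (λ a b c → c :* (a :* b) := c :* b :* a) refl a b c ⟩
      c * b * a ≈⟨ *-congʳ cb≈b⁴ ⟩
      b * (b * (b * b)) * a ≈⟨ solve 2 (λ a b → b :* (b :* (b :* b)) :* a := a :* b :* (b :* (b :* b))) refl a b ⟩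
      a * b * (b * (b * b)) ≈⟨ *-congʳ ab≈1 ⟩
      1# * (b * (b * b)) ≈⟨ *-identityˡ _ ⟩
      b * (b * b) ∎

    -- Gauss's identity φ(-q) = ∏ (1 - qⁱ)/(1 + qⁱ), with A k in the role of ∏_{i ≤ k} (1 + xⁱ)/(1 - xⁱ).
    module Gauss (x : Carrier) (A : ℕ → Carrier) (A-zero : A 0 ≈ 1#)
      (A-suc : ∀ k → A (suc k) ≈ A k + x ^ suc k * (A (suc k) + A k)) where

      -- The partial sum 1 + 2 ∑ (-1)ʲ x^(j²) over 1 ≤ j ≤ k. Writing the summand as (-xʲ)ʲ makes it
      -- a power of u = -xʲ, the quantity on which the induction for `A*theta≈H` runs.
      theta : ℕ → Carrier
      theta zero = 1#
      theta (suc k) = theta k + (1# + 1#) * (-1# * x ^ suc k) ^ suc k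

      -- With A as in the product, A j + A (j - 1) = (-1; x)ⱼ / (x; x)ⱼ. So this is a partial sum of
      -- the q-binomial series for (-u; x)∞ / (u; x)∞.
      H : ℕ → Carrier → Carrier
      H zero u = 1#
      H (suc s) u = H s u + (A (suc s) + A s) * u ^ suc s

      H-cong : ∀ s {u v} → u ≈ v → H s u ≈ H s v
      H-cong zero u≈v = refl
      H-cong (suc s) u≈v = +-cong (H-cong s u≈v) (*-congˡ (^-congˡ (suc s) u≈v))

      -- The full series F satisfies (1 + u) F(xu) = (1 - u) F(u); the last term is the error made
      -- by stopping after degree s.
      H-telescope : ∀ s u → (1# + u) * H s (x * u) ≈
                            (1# + -1# * u) * H s u + (1# + 1#) * A s * u ^ suc s
      H-telescope zero u = begin
        (1# + u) * 1#
          ≈⟨ solve 1 (λ u → (con 1 :+ u) :* con 1 :=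
               (con 1 :+ :-1 :* u) :* con 1 :+ (con 1 :+ con 1) :* con 1 :* (u :* con 1)) refl u ⟩
        (1# + -1# * u) * 1# + (1# + 1#) * 1# * (u * 1#)
          ≈⟨ +-congˡ (*-congʳ (*-congˡ A-zero)) ⟨
        (1# + -1# * u) * 1# + (1# + 1#) * A 0 * (u * 1#) ∎
      H-telescope (suc s) u = begin
        (1# + u) * (H s (x * u) + B * (x * u) ^ t)
          ≈⟨ *-congˡ (+-congˡ (*-congˡ (^-distrib-* x u t))) ⟩
        (1# + u) * (H s (x * u) + B * (X * p))
          ≈⟨ solve 5 (λ u h b X p → (con 1 :+ u) :* (h :+ b :* (X :* p)) :=
               (con 1 :+ u) :* h :+ (con 1 :+ u) :* p :* (X :* b)) refl u (H s (x * u)) B X p ⟩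
        (1# + u) * H s (x * u) + (1# + u) * p * (X * B)
          ≈⟨ +-congʳ (H-telescope s u) ⟩
        (1# + -1# * u) * H s u + (1# + 1#) * A s * p + (1# + u) * p * (X * B)
          ≈⟨ solve 5 (λ u h a XB p →
               (con 1 :+ :-1 :* u) :* h :+ (con 1 :+ con 1) :* a :* p :+ (con 1 :+ u) :* p :* XB :=
               (con 1 :+ :-1 :* u) :* (h :+ ((a :+ XB) :+ a) :* p) :+ (con 1 :+ con 1) :* (a :+ XB) :* (u :* p))
               refl u (H s u) (A s) (X * B) p ⟩
        (1# + -1# * u) * (H s u + ((A s + X * B) + A s) * p) + (1# + 1#) * (A s + X * B) * (u * p)
          ≈⟨ +-cong (*-congˡ (+-congˡ (*-congʳ (+-congʳ (A-suc s))))) (*-congʳ (*-congˡ (A-suc s))) ⟨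
        (1# + -1# * u) * (H s u + B * p) + (1# + 1#) * A t * (u * p) ∎
        where
        t = suc s
        B = A t + A s
        X = x ^ t
        p = u ^ t

      module _ (n : ℕ) (x^n≈0 : x ^ n ≈ 0#) where

        -- A finite form of Gauss's identity, by induction. Multiply the claim for s + 1 by 1 + u,
        -- where u = -x^(s+1). Then (1 + u) A (s + 1) = (1 - u) A s brings in the induction
        -- hypothesis, whose argument is u, and `H-telescope` moves the argument on to xu.
        -- Nilpotence of u allows 1 + u to be cancelled.
        A*theta≈H : ∀ k → A k * theta k ≈ H k (-1# * x ^ suc k)
        A*theta≈H zero = trans (*-identityʳ _) A-zero
        A*theta≈H (suc s) = 1+nilpotent-cancelˡ {u} n u^n≈0 (begin
          (1# + u) * (A t * (theta s + (1# + 1#) * p))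
            ≈⟨ solve 4 (λ X a θ p → (con 1 :+ :-1 :* X) :* (a :* (θ :+ (con 1 :+ con 1) :* p)) :=
                 (a :+ :-1 :* X :* a) :* θ :+ (con 1 :+ con 1) :* (a :+ :-1 :* X :* a) :* p) refl X (A t) (theta s) p ⟩
          (A t + -1# * X * A t) * theta s + (1# + 1#) * (A t + -1# * X * A t) * p
            ≈⟨ +-congʳ (*-congʳ factor) ⟩
          (1# + -1# * u) * A s * theta s + (1# + 1#) * (A t + -1# * X * A t) * p
            ≈⟨ +-congʳ (trans (*-assoc _ _ _) (*-congˡ (A*theta≈H s))) ⟩
          (1# + -1# * u) * H s u + (1# + 1#) * (A t + -1# * X * A t) * p
            ≈⟨ solve 4 (λ X h a p →
                 (con 1 :+ :-1 :* (:-1 :* X)) :* h :+ (con 1 :+ con 1) :* (a :+ :-1 :* X :* a) :* p :=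
                 (con 1 :+ :-1 :* (:-1 :* X)) :* h :+ (a :+ a) :* p :+ (con 1 :+ con 1) :* a :* (:-1 :* X :* p))
                 refl X (H s u) (A t) p ⟩
          (1# + -1# * u) * H s u + (A t + A t) * p + (1# + 1#) * A t * (u * p)
            ≈⟨ +-congʳ (+-congˡ (*-congʳ factor′)) ⟨
          (1# + -1# * u) * H s u + (1# + -1# * u) * B * p + (1# + 1#) * A t * (u * p)
            ≈⟨ +-congʳ (trans (+-congˡ (*-assoc _ _ _)) (sym (distribˡ _ _ _))) ⟩
          (1# + -1# * u) * (H s u + B * p) + (1# + 1#) * A t * (u * p)
            ≈⟨ H-telescope t u ⟨
          (1# + u) * H t (x * u)
            ≈⟨ *-congˡ (H-cong t (solve 2 (λ x X → x :* (:-1 :* X) := :-1 :* (x :* X)) refl x X)) ⟩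
          (1# + u) * H t (-1# * x ^ suc t) ∎)
          where
          t = suc s
          B = A t + A s
          X = x ^ t
          u = -1# * X
          p = u ^ t

          u^n≈0 : u ^ n ≈ 0#
          u^n≈0 = [-1*a]^n≈0 n (trans (^-distrib-* x (x ^ s) n) (trans (*-congʳ x^n≈0) (zeroˡ _)))

          factor : A t + -1# * X * A t ≈ (1# + -1# * u) * A s
          factor = begin
            A t + -1# * X * A t
              ≈⟨ +-congʳ (A-suc s) ⟩
            A s + X * (A t + A s) + -1# * X * A t
              ≈⟨ solve 3 (λ a b X → b :+ X :* (a :+ b) :+ :-1 :* X :* a :=
                   (con 1 :+ :-1 :* (:-1 :* X)) :* b) refl (A t) (A s) X ⟩
            (1# + -1# * u) * A s ∎

          factor′ : (1# + -1# * u) * B ≈ A t + A t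
          factor′ = begin
            (1# + -1# * u) * B
              ≈⟨ solve 3 (λ a b X → (con 1 :+ :-1 :* (:-1 :* X)) :* (a :+ b) :=
                   a :+ (b :+ X :* (a :+ b))) refl (A t) (A s) X ⟩
            A t + (A s + X * B)
              ≈⟨ +-congˡ (A-suc s) ⟨
            A t + A t ∎

      -- The argument of `H` is now 0, which leaves its constant term.
      A*theta≈1 : ∀ k → x ^ suc k ≈ 0# → A k * theta k ≈ 1#
      A*theta≈1 k x^1+k≈0 = trans (A*theta≈H (suc k) x^1+k≈0 k)
        (trans (H-cong k (trans (*-congˡ x^1+k≈0) (zeroʳ _))) (H-zero k))
        where
        H-zero : ∀ s → H s 0# ≈ 1#
        H-zero zero = refl
        H-zero (suc s) = trans (+-cong (H-zero s) (trans (*-congˡ (zeroˡ _)) (zeroʳ _))) (+-identityʳ 1#)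

      theta≈sum : ∀ k → theta k ≈ sum (interval k) (λ a → (-1# * x) ^ (∣ a ∣ ℕ.* ∣ a ∣))
      theta≈sum zero = sym (+-identityʳ 1#)
      theta≈sum (suc k) = begin
        theta k + (1# + 1#) * (-1# * x ^ t) ^ t
          ≈⟨ solve 2 (λ a b → a :+ (con 1 :+ con 1) :* b := b :+ (b :+ a)) refl (theta k) _ ⟩
        (-1# * x ^ t) ^ t + ((-1# * x ^ t) ^ t + theta k)
          ≈⟨ +-cong power (+-cong power (theta≈sum k)) ⟩
        (-1# * x) ^ (t ℕ.* t) + ((-1# * x) ^ (t ℕ.* t) + sum (interval k) _) ∎
        where
        t = suc k

        power : (-1# * x ^ t) ^ t ≈ (-1# * x) ^ (t ℕ.* t)
        power = begin
          (-1# * x ^ t) ^ t ≈⟨ ^-distrib-* -1# (x ^ t) t ⟩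
          -1# ^ t * (x ^ t) ^ t ≈⟨ *-cong (-1^n*n≈-1^n t) (sym (^-assocʳ x t t)) ⟨
          -1# ^ (t ℕ.* t) * x ^ (t ℕ.* t) ≈⟨ ^-distrib-* -1# x (t ℕ.* t) ⟨
          (-1# * x) ^ (t ℕ.* t) ∎

-- Truncated power series modulo 7.

module PowerSeries where

  open import Algebra using (CommutativeSemiring)
  open import Data.Nat
  open import Data.Nat.DivMod using (%-distribˡ-+; %-distribˡ-*)
  open import Data.Nat.Properties
  open import Data.Nat.Solver using (module +-*-Solver)
  open import Data.Product using (_,_)
  open import Function using (_∘_)
  open import Level using (0ℓ)
  open import Relation.Binary.PropositionalEquality

  infix 4 _≡₇_
  _≡₇_ : ℕ → ℕ → Set
  m ≡₇ n = m % 7 ≡ n % 7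

  +-cong-≡₇ : ∀ {a b c d} → a ≡₇ b → c ≡₇ d → a + c ≡₇ b + d
  +-cong-≡₇ {a} {b} {c} {d} a≡b c≡d = trans (%-distribˡ-+ a c 7)
    (trans (cong₂ (λ x y → (x + y) % 7) a≡b c≡d) (sym (%-distribˡ-+ b d 7)))

  *-cong-≡₇ : ∀ {a b c d} → a ≡₇ b → c ≡₇ d → a * c ≡₇ b * d
  *-cong-≡₇ {a} {b} {c} {d} a≡b c≡d = trans (%-distribˡ-* a c 7)
    (trans (cong₂ (λ x y → (x * y) % 7) a≡b c≡d) (sym (%-distribˡ-* b d 7)))

  sum0to-cong-≡₇ : ∀ n {f g} → (∀ i → i ≤ n → f i ≡₇ g i) → sum0to n f ≡₇ sum0to n g
  sum0to-cong-≡₇ zero f≡g = f≡g 0 z≤n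
  sum0to-cong-≡₇ (suc n) {f} {g} f≡g = +-cong-≡₇ {sum0to n f} {sum0to n g}
    (sum0to-cong-≡₇ n (λ i i≤n → f≡g i (m≤n⇒m≤1+n i≤n))) (f≡g (suc n) ≤-refl)

  sum0to-cong : ∀ n {f g} → f ≗ g → sum0to n f ≡ sum0to n g
  sum0to-cong zero f≗g = f≗g 0
  sum0to-cong (suc n) f≗g = cong₂ _+_ (sum0to-cong n f≗g) (f≗g (suc n))

  sum0to-suc : ∀ n f → sum0to (suc n) f ≡ f 0 + sum0to n (f ∘ suc)
  sum0to-suc zero f = refl
  sum0to-suc (suc n) f = trans (cong (_+ f (2 + n)) (sum0to-suc n f)) (+-assoc (f 0) _ _)

  sum0to-+ : ∀ n f g → sum0to n (λ i → f i + g i) ≡ sum0to n f + sum0to n g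
  sum0to-+ zero f g = refl
  sum0to-+ (suc n) f g = trans (cong (_+ (f (suc n) + g (suc n))) (sum0to-+ n f g))
    (solve 4 (λ a b c d → (a :+ b) :+ (c :+ d) := (a :+ c) :+ (b :+ d)) refl
      (sum0to n f) (sum0to n g) (f (suc n)) (g (suc n)))
    where open +-*-Solver

  sum0to-*ˡ : ∀ n c f → sum0to n (λ i → c * f i) ≡ c * sum0to n f
  sum0to-*ˡ zero c f = refl
  sum0to-*ˡ (suc n) c f = trans (cong (_+ c * f (suc n)) (sum0to-*ˡ n c f))
    (sym (*-distribˡ-+ c (sum0to n f) (f (suc n))))

  Series : Set
  Series = ℕ → ℕ

  tail : Series → Series
  tail f = f ∘ suc

  infixl 6 _⊕_
  infixl 7 _⊛_ _⊙_

  _⊕_ : Series → Series → Series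
  (f ⊕ g) n = f n + g n

  _⊙_ : ℕ → Series → Series
  (c ⊙ f) n = c * f n

  _⊛_ : Series → Series → Series
  (f ⊛ g) n = sum0to n (λ i → f i * g (n ∸ i))

  𝟘 𝟙 : Series
  𝟘 n = 0
  𝟙 zero = 1
  𝟙 (suc n) = 0

  ⊛-suc : ∀ f g n → (f ⊛ g) (suc n) ≡ f 0 * g (suc n) + (tail f ⊛ g) n
  ⊛-suc f g n = sum0to-suc n (λ i → f i * g (suc n ∸ i))

  ⊛-congʳ : ∀ h {f g} → f ≗ g → f ⊛ h ≗ g ⊛ h
  ⊛-congʳ h f≗g n = sum0to-cong n (λ i → cong (_* h (n ∸ i)) (f≗g i))

  ⊛-distribˡ-⊕ : ∀ f g h → f ⊛ (g ⊕ h) ≗ f ⊛ g ⊕ f ⊛ h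
  ⊛-distribˡ-⊕ f g h n = trans (sum0to-cong n (λ i → *-distribˡ-+ (f i) (g (n ∸ i)) (h (n ∸ i))))
    (sum0to-+ n _ _)

  ⊛-distribʳ-⊕ : ∀ h f g → (f ⊕ g) ⊛ h ≗ f ⊛ h ⊕ g ⊛ h
  ⊛-distribʳ-⊕ h f g n = trans (sum0to-cong n (λ i → *-distribʳ-+ (h (n ∸ i)) (f i) (g i)))
    (sum0to-+ n _ _)

  ⊙-⊛-assoc : ∀ c f g → (c ⊙ f) ⊛ g ≗ c ⊙ (f ⊛ g)
  ⊙-⊛-assoc c f g n = trans (sum0to-cong n (λ i → *-assoc c (f i) (g (n ∸ i)))) (sum0to-*ˡ n c _)

  ⊛-zeroˡ : ∀ g → 𝟘 ⊛ g ≗ 𝟘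
  ⊛-zeroˡ g n = sum0to-*ˡ n 0 (λ i → g (n ∸ i))

  ⊛-identityˡ : ∀ g → 𝟙 ⊛ g ≗ g
  ⊛-identityˡ g zero = *-identityˡ (g 0)
  ⊛-identityˡ g (suc n) = trans (⊛-suc 𝟙 g n)
    (trans (cong₂ _+_ (*-identityˡ (g (suc n))) (⊛-zeroˡ g n)) (+-identityʳ _))

  -- Peeling the first coefficient off f and then off g leaves the product of the two tails at n,
  -- where induction applies; hence the recursion in steps of two and the separate case 1.
  ⊛-comm : ∀ f g → f ⊛ g ≗ g ⊛ f
  ⊛-comm f g zero = *-comm (f 0) (g 0)
  ⊛-comm f g (suc zero) = solve 4 (λ a b c d → a :* d :+ b :* c := c :* b :+ d :* a) refl (f 0) (f 1) (g 0) (g 1)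
    where open +-*-Solver
  ⊛-comm f g (suc (suc n)) = begin
    (f ⊛ g) (2 + n) ≡⟨ expand f g (⊛-comm (tail f) g (suc n)) ⟩
    f 0 * g (2 + n) + (g 0 * f (2 + n) + (tail g ⊛ tail f) n)
      ≡⟨ solve 3 (λ a b c → a :+ (b :+ c) := b :+ (a :+ c)) refl (f 0 * g (2 + n)) (g 0 * f (2 + n)) _ ⟩
    g 0 * f (2 + n) + (f 0 * g (2 + n) + (tail g ⊛ tail f) n)
      ≡⟨ cong (λ s → g 0 * f (2 + n) + (f 0 * g (2 + n) + s)) (⊛-comm (tail g) (tail f) n) ⟩
    g 0 * f (2 + n) + (f 0 * g (2 + n) + (tail f ⊛ tail g) n) ≡⟨ expand g f (⊛-comm (tail g) f (suc n)) ⟨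
    (g ⊛ f) (2 + n) ∎
    where
    open ≡-Reasoning
    open +-*-Solver using (solve; _:+_; _:=_)
    expand : ∀ f g → (tail f ⊛ g) (suc n) ≡ (g ⊛ tail f) (suc n) →
             (f ⊛ g) (2 + n) ≡ f 0 * g (2 + n) + (g 0 * f (2 + n) + (tail g ⊛ tail f) n)
    expand f g comm = trans (⊛-suc f g (suc n)) (cong (f 0 * g (2 + n) +_)
      (trans comm (⊛-suc g (tail f) n)))

  ⊛-assoc : ∀ f g h → (f ⊛ g) ⊛ h ≗ f ⊛ (g ⊛ h)
  ⊛-assoc f g h zero = *-assoc (f 0) (g 0) (h 0)
  ⊛-assoc f g h (suc n) = begin
    ((f ⊛ g) ⊛ h) (suc n)
      ≡⟨ ⊛-suc (f ⊛ g) h n ⟩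
    f 0 * g 0 * h (suc n) + (tail (f ⊛ g) ⊛ h) n
      ≡⟨ cong (f 0 * g 0 * h (suc n) +_) (⊛-congʳ h (⊛-suc f g) n) ⟩
    f 0 * g 0 * h (suc n) + ((f 0 ⊙ tail g ⊕ tail f ⊛ g) ⊛ h) n
      ≡⟨ cong (f 0 * g 0 * h (suc n) +_) (⊛-distribʳ-⊕ h (f 0 ⊙ tail g) (tail f ⊛ g) n) ⟩
    f 0 * g 0 * h (suc n) + (((f 0 ⊙ tail g) ⊛ h) n + ((tail f ⊛ g) ⊛ h) n)
      ≡⟨ cong₂ (λ s t → f 0 * g 0 * h (suc n) + (s + t)) (⊙-⊛-assoc (f 0) (tail g) h n) (⊛-assoc (tail f) g h n) ⟩
    f 0 * g 0 * h (suc n) + (f 0 * (tail g ⊛ h) n + (tail f ⊛ (g ⊛ h)) n)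
      ≡⟨ solve 5 (λ a b c d e → a :* b :* c :+ (a :* d :+ e) := a :* (b :* c :+ d) :+ e) refl
           (f 0) (g 0) (h (suc n)) ((tail g ⊛ h) n) _ ⟩
    f 0 * (g 0 * h (suc n) + (tail g ⊛ h) n) + (tail f ⊛ (g ⊛ h)) n
      ≡⟨ cong (λ s → f 0 * s + (tail f ⊛ (g ⊛ h)) n) (⊛-suc g h n) ⟨
    f 0 * (g ⊛ h) (suc n) + (tail f ⊛ (g ⊛ h)) n
      ≡⟨ ⊛-suc f (g ⊛ h) n ⟨
    (f ⊛ (g ⊛ h)) (suc n) ∎
    where
    open ≡-Reasoning
    open +-*-Solver using (solve; _:+_; _:*_; _:=_)

  infix 4 _≈[_]_
  record _≈[_]_ (f : Series) (N : ℕ) (g : Series) : Set where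
    constructor coefficients
    field coefficient : ∀ n → n ≤ N → f n ≡₇ g n
  open _≈[_]_ public

  ≗⇒≈ : ∀ {N f g} → f ≗ g → f ≈[ N ] g
  ≗⇒≈ f≗g = coefficients λ n _ → cong (_% 7) (f≗g n)

  ≈-mono : ∀ {M N f g} → M ≤ N → f ≈[ N ] g → f ≈[ M ] g
  ≈-mono M≤N f≈g = coefficients λ n n≤M → coefficient f≈g n (≤-trans n≤M M≤N)

  ⊛-cong-≈ : ∀ {N f g h k} → f ≈[ N ] g → h ≈[ N ] k → f ⊛ h ≈[ N ] g ⊛ k
  ⊛-cong-≈ {N} {f} {g} f≈g h≈k = coefficients λ n n≤N → sum0to-cong-≡₇ n λ i i≤n →
    *-cong-≡₇ {f i} {g i} (coefficient f≈g i (≤-trans i≤n n≤N))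
      (coefficient h≈k (n ∸ i) (≤-trans (m∸n≤m n i) n≤N))

  -- The power series over ℤ/7, truncated after the coefficient of index N.
  seriesSemiring : ℕ → CommutativeSemiring 0ℓ 0ℓ
  seriesSemiring N = record
    { Carrier = Series
    ; _≈_ = _≈[ N ]_
    ; _+_ = _⊕_
    ; _*_ = _⊛_
    ; 0# = 𝟘
    ; 1# = 𝟙
    ; isCommutativeSemiring = record
      { isSemiring = record
        { isSemiringWithoutAnnihilatingZero = record
          { +-isCommutativeMonoid = record
            { isMonoid = record
              { isSemigroup = record
                { isMagma = record
                  { isEquivalence = record
                    { refl = coefficients λ _ _ → refl
                    ; sym = λ f≈g → coefficients λ n n≤N → sym (coefficient f≈g n n≤N)
                    ; trans = λ f≈g g≈h → coefficients λ n n≤N →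
                        trans (coefficient f≈g n n≤N) (coefficient g≈h n n≤N)
                    }
                  ; ∙-cong = λ {f} {g} f≈g h≈k → coefficients λ n n≤N →
                      +-cong-≡₇ {f n} {g n} (coefficient f≈g n n≤N) (coefficient h≈k n n≤N)
                  }
                ; assoc = λ f g h → ≗⇒≈ λ n → +-assoc (f n) (g n) (h n)
                }
              ; identity = (λ f → ≗⇒≈ λ n → refl) , (λ f → ≗⇒≈ λ n → +-identityʳ (f n))
              }
            ; comm = λ f g → ≗⇒≈ λ n → +-comm (f n) (g n)
            }
          ; *-cong = ⊛-cong-≈
          ; *-assoc = λ f g h → ≗⇒≈ (⊛-assoc f g h)
          ; *-identity = (λ f → ≗⇒≈ (⊛-identityˡ f)) ,
                         (λ f → ≗⇒≈ λ n → trans (⊛-comm f 𝟙 n) (⊛-identityˡ f n))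
          ; distrib = (λ f g h → ≗⇒≈ (⊛-distribˡ-⊕ f g h)) , (λ f g h → ≗⇒≈ (⊛-distribʳ-⊕ f g h))
          }
        ; zero = (λ f → ≗⇒≈ (⊛-zeroˡ f)) , (λ f → ≗⇒≈ λ n → trans (⊛-comm f 𝟘 n) (⊛-zeroˡ f n))
        }
      ; *-comm = λ f g → ≗⇒≈ (⊛-comm f g)
      }
    }

-- The overpartition series, powers of theta, and extraction of the exponents divisible by 7.

module Overpartitions where

  open import Algebra using (CommutativeSemiring)
  import Algebra.Properties.Semiring.Exp as Exp
  open import Data.Bool using (if_then_else_)
  open import Data.Integer using (ℤ; ∣_∣)
  open import Data.List using (List; []; _∷_; length; filter; cartesianProduct)
  open import Data.List.Properties using (filter-accept; filter-reject)
  open import Data.Nat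
  open import Data.Nat.Properties
  open import Data.Nat.Solver using (module +-*-Solver)
  open import Data.Product using (_×_; _,_)
  open import Function using (_∘_)
  open import Relation.Binary.PropositionalEquality hiding (setoid)
  open import Relation.Nullary using (yes; no; does; contradiction)
  open import Relation.Nullary.Decidable using (dec-true; dec-false)

  open CharacteristicSeven
  open PowerSeries

  shift : ℕ → Series → Series
  shift zero f n = f n
  shift (suc e) f zero = 0
  shift (suc e) f (suc n) = shift e f n

  shift-cong : ∀ e {f g} → f ≗ g → shift e f ≗ shift e g
  shift-cong zero f≗g n = f≗g n
  shift-cong (suc e) f≗g zero = refl
  shift-cong (suc e) f≗g (suc n) = shift-cong e f≗g n

  shift-+ : ∀ e f n → shift e f (e + n) ≡ f n
  shift-+ zero f n = refl
  shift-+ (suc e) f n = shift-+ e f n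

  shift-< : ∀ {e n} f → n < e → shift e f n ≡ 0
  shift-< {suc e} {zero} f _ = refl
  shift-< {suc e} {suc n} f (s≤s n<e) = shift-< f n<e

  shift-⊙ : ∀ e c f → shift e (c ⊙ f) ≗ c ⊙ shift e f
  shift-⊙ zero c f n = refl
  shift-⊙ (suc e) c f zero = sym (*-zeroʳ c)
  shift-⊙ (suc e) c f (suc n) = shift-⊙ e c f n

  shift-∘ : ∀ d e f → shift d (shift e f) ≗ shift (d + e) f
  shift-∘ zero e f n = refl
  shift-∘ (suc d) e f zero = refl
  shift-∘ (suc d) e f (suc n) = shift-∘ d e f n

  shift-𝟙-⊛ : ∀ e f → shift e 𝟙 ⊛ f ≗ shift e f
  shift-𝟙-⊛ zero f n = ⊛-identityˡ f n
  shift-𝟙-⊛ (suc e) f zero = refl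
  shift-𝟙-⊛ (suc e) f (suc n) = trans (⊛-suc (shift (suc e) 𝟙) f n) (shift-𝟙-⊛ e f n)

  sum1to-cong : ∀ n {f g} → f ≗ g → sum1to n f ≡ sum1to n g
  sum1to-cong zero f≗g = refl
  sum1to-cong (suc n) f≗g = cong₂ _+_ (sum1to-cong n f≗g) (f≗g (suc n))

  sum1to-suc : ∀ n f → sum1to (suc n) f ≡ f 1 + sum1to n (f ∘ suc)
  sum1to-suc zero f = sym (+-identityʳ (f 1))
  sum1to-suc (suc n) f = trans (cong (_+ f (2 + n)) (sum1to-suc n f)) (+-assoc (f 1) _ _)

  sum1to-extend : ∀ k n {f} → (∀ m → n < m → f m ≡ 0) → sum1to (k + n) f ≡ sum1to n f
  sum1to-extend zero n f≡0 = refl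
  sum1to-extend (suc k) n f≡0 =
    trans (cong₂ _+_ (sum1to-extend k n f≡0) (f≡0 (suc k + n) (s≤s (m≤n+m n k)))) (+-identityʳ _)

  module _ (k : ℕ) (f : Series) where

    private
      term : ℕ → ℕ → ℕ
      term n m = if does (m * suc k ≤? n) then f (n ∸ m * suc k) else 0

      term-≰ : ∀ n m → n < m * suc k → term n m ≡ 0
      term-≰ n m n<mk rewrite dec-false (m * suc k ≤? n) (<⇒≱ n<mk) = refl

      term-suc : ∀ p m → term (suc k + p) (suc m) ≡ term p m
      term-suc p m with m * suc k ≤? p
      ... | yes mk≤p
        rewrite dec-true (m * suc k ≤? p) mk≤p
              | dec-true (suc m * suc k ≤? suc k + p) (+-monoʳ-≤ (suc k) mk≤p) =
        cong f ([m+n]∸[m+o]≡n∸o (suc k) p (m * suc k))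
      ... | no mk≰p
        rewrite dec-false (m * suc k ≤? p) mk≰p
              | dec-false (suc m * suc k ≤? suc k + p) (mk≰p ∘ +-cancelˡ-≤ (suc k) _ _) = refl

      >-term : ∀ n m → n < m → term n m ≡ 0
      >-term n m n<m = term-≰ n m (<-≤-trans n<m (m≤m*n m (suc k)))

    -- The series f · q^(k+1) / (1 - q^(k+1)), spelled as the inner sum of `ovParts` so that the two
    -- agree by definition.
    multiples : Series
    multiples n = sum1to n (term n)

    -- The summand m = 1 gives f, and lowering m by one in the others gives the same sum again: the
    -- geometric series characterised without division.
    multiples-shift : multiples ≗ shift (suc k) (f ⊕ multiples)
    multiples-shift n with suc k ≤? n
    ... | yes k<n = begin
      multiples n
        ≡⟨ cong multiples (m+[n∸m]≡n k<n) ⟨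
      sum1to (suc (k + p)) (term (suc k + p))
        ≡⟨ sum1to-suc (k + p) _ ⟩
      term (suc k + p) 1 + sum1to (k + p) (term (suc k + p) ∘ suc)
        ≡⟨ cong₂ _+_ (term-suc p 0) (sum1to-cong (k + p) (term-suc p)) ⟩
      f p + sum1to (k + p) (term p)
        -- The sum still runs up to k + p, but for m > p also m (k + 1) > p, and such terms are 0.
        ≡⟨ cong (f p +_) (sum1to-extend k p (>-term p)) ⟩
      (f ⊕ multiples) p
        ≡⟨ shift-+ (suc k) (f ⊕ multiples) p ⟨
      shift (suc k) (f ⊕ multiples) (suc k + p)
        ≡⟨ cong (shift (suc k) (f ⊕ multiples)) (m+[n∸m]≡n k<n) ⟩
      shift (suc k) (f ⊕ multiples) n ∎
      where
      open ≡-Reasoning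
      p = n ∸ suc k
    ... | no k≮n = trans vanish (sym (shift-< (f ⊕ multiples) (≰⇒> k≮n)))
      where
      vanish : multiples n ≡ 0
      vanish = trans (cong (λ l → sum1to l (term n)) (sym (+-identityʳ n)))
        (sum1to-extend n 0 (λ m 0<m → term-≰ n m
          (<-≤-trans (≰⇒> k≮n) (m≤n*m (suc k) m {{>-nonZero 0<m}}))))

  -- This is (1 - q^(k+1)) P_{k+1} = (1 + q^(k+1)) P_k with the subtraction moved across, the
  -- recurrence demanded by `Gauss`.
  ovParts-suc : ∀ k → ovParts (suc k) ≗ ovParts k ⊕ shift (suc k) (ovParts (suc k) ⊕ ovParts k)
  ovParts-suc k n = cong (f n +_) (begin
    2 * multiples k f n
      ≡⟨ cong (2 *_) (multiples-shift k f n) ⟩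
    2 * shift (suc k) (f ⊕ multiples k f) n
      ≡⟨ shift-⊙ (suc k) 2 (f ⊕ multiples k f) n ⟨
    shift (suc k) (2 ⊙ (f ⊕ multiples k f)) n
      ≡⟨ shift-cong (suc k) (λ m → solve 2 (λ a b → con 2 :* (a :+ b) := (a :+ con 2 :* b) :+ a) refl
           (f m) (multiples k f m)) n ⟩
    shift (suc k) (ovParts (suc k) ⊕ f) n ∎)
    where
    open ≡-Reasoning
    open +-*-Solver
    f = ovParts k

  -- Admitting parts of size N + 1 > n alters only coefficients beyond n.
  ovParts≡pbar : ∀ {n N} → n ≤′ N → ovParts N n ≡ pbar n
  ovParts≡pbar ≤′-refl = refl
  ovParts≡pbar {n} (≤′-step {N} n≤N) = trans (ovParts-suc N n)
    (trans (cong (ovParts N n +_) (shift-< _ (s≤s (≤′⇒≤ n≤N))))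
      (trans (+-identityʳ _) (ovParts≡pbar n≤N)))

  pbar3≗pbar³ : pbar3 ≗ pbar ⊛ (pbar ⊛ pbar)
  pbar3≗pbar³ n = sum0to-cong n λ i →
    trans (sum0to-cong (n ∸ i) (λ j → *-assoc (pbar i) (pbar j) (pbar (n ∸ i ∸ j))))
      (sum0to-*ˡ (n ∸ i) (pbar i) _)

  -- (-q)ᵉ, with -1 represented by 6.
  monomial : ℕ → Series
  monomial e = 6 ^ e ⊙ shift e 𝟙

  monomial-⊛ : ∀ e f → monomial e ⊛ f ≗ 6 ^ e ⊙ shift e f
  monomial-⊛ e f n = trans (⊙-⊛-assoc (6 ^ e) (shift e 𝟙) f n) (cong (6 ^ e *_) (shift-𝟙-⊛ e f n))

  monomial-+ : ∀ d e → monomial d ⊛ monomial e ≗ monomial (d + e)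
  monomial-+ d e n = begin
    (monomial d ⊛ monomial e) n ≡⟨ monomial-⊛ d (monomial e) n ⟩
    6 ^ d * shift d (6 ^ e ⊙ shift e 𝟙) n ≡⟨ cong (6 ^ d *_) (shift-⊙ d (6 ^ e) (shift e 𝟙) n) ⟩
    6 ^ d * (6 ^ e * shift d (shift e 𝟙) n) ≡⟨ *-assoc (6 ^ d) (6 ^ e) _ ⟨
    6 ^ d * 6 ^ e * shift d (shift e 𝟙) n ≡⟨ cong₂ _*_ (^-distribˡ-+-* 6 d e) (sym (shift-∘ d e 𝟙 n)) ⟨
    monomial (d + e) n ∎
    where open ≡-Reasoning

  -- Fermat's little theorem: the sign (-1)ⁿ is unchanged when n is replaced by 7n.
  6^7n≡6^n : ∀ n → 6 ^ (7 * n) ≡₇ 6 ^ n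
  6^7n≡6^n zero = refl
  6^7n≡6^n (suc n) = begin
    6 ^ (7 * suc n) % 7 ≡⟨ cong (λ e → 6 ^ e % 7) (*-suc 7 n) ⟩
    6 ^ (7 + 7 * n) % 7 ≡⟨ cong (_% 7) (^-distribˡ-+-* 6 7 (7 * n)) ⟩
    (6 ^ 7 * 6 ^ (7 * n)) % 7 ≡⟨ *-cong-≡₇ {6 ^ 7} {6} {6 ^ (7 * n)} {6 ^ n} refl (6^7n≡6^n n) ⟩
    6 ^ suc n % 7 ∎
    where open ≡-Reasoning

  module _ {a} {A : Set a} where

    ∑ : List A → (A → ℕ) → ℕ
    ∑ [] f = 0
    ∑ (a ∷ as) f = f a + ∑ as f

    ∑-cong : ∀ as {f g : A → ℕ} → (∀ a → f a ≡₇ g a) → ∑ as f ≡₇ ∑ as g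
    ∑-cong [] f≡g = refl
    ∑-cong (a ∷ as) {f} {g} f≡g = +-cong-≡₇ {f a} {g a} (f≡g a) (∑-cong as f≡g)

    ∑-⊛ : ∀ as (F : A → Series) g → (λ m → ∑ as (λ a → F a m)) ⊛ g ≗ (λ n → ∑ as (λ a → (F a ⊛ g) n))
    ∑-⊛ [] F g n = ⊛-zeroˡ g n
    ∑-⊛ (a ∷ as) F g n =
      trans (⊛-distribʳ-⊕ g (F a) (λ m → ∑ as (λ a → F a m)) n) (cong ((F a ⊛ g) n +_) (∑-⊛ as F g n))

    -- All monomials of degree n carry the same sign 6ⁿ, so the coefficient is that sign times a
    -- count.
    ∑-monomial : ∀ as (e : A → ℕ) n →
                 ∑ as (λ a → monomial (e a) n) ≡ 6 ^ n * length (filter (λ a → e a ≟ n) as)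
    ∑-monomial [] e n = sym (*-zeroʳ (6 ^ n))
    ∑-monomial (a ∷ as) e n with e a ≟ n
    ... | yes refl = begin
      6 ^ e a * shift (e a) 𝟙 (e a) + ∑ as _
        ≡⟨ cong₂ (λ s t → 6 ^ e a * s + t)
             (trans (cong (shift (e a) 𝟙) (sym (+-identityʳ (e a)))) (shift-+ (e a) 𝟙 0))
             (∑-monomial as e (e a)) ⟩
      6 ^ e a * 1 + 6 ^ e a * length (filter (λ b → e b ≟ e a) as)
        ≡⟨ *-distribˡ-+ (6 ^ e a) 1 _ ⟨
      6 ^ e a * suc (length (filter (λ b → e b ≟ e a) as))
        ≡⟨ cong (λ l → 6 ^ e a * length l) (filter-accept (λ b → e b ≟ e a) refl) ⟨
      6 ^ e a * length (filter (λ b → e b ≟ e a) (a ∷ as)) ∎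
      where open ≡-Reasoning
    ... | no e≢n = trans
      (cong₂ _+_ (trans (cong (6 ^ e a *_) (off (e a) n e≢n)) (*-zeroʳ (6 ^ e a))) (∑-monomial as e n))
      (cong (λ l → 6 ^ n * length l) (sym (filter-reject (λ b → e b ≟ n) e≢n)))
      where
      off : ∀ e n → e ≢ n → shift e 𝟙 n ≡ 0
      off zero zero e≢n = contradiction refl e≢n
      off zero (suc n) e≢n = refl
      off (suc e) zero e≢n = refl
      off (suc e) (suc n) e≢n = off e n (e≢n ∘ cong suc)

  -- φ(-q), correct through degree N, because a² ≤ N forces ∣ a ∣ ≤ N.
  theta : ℕ → Series
  theta N n = ∑ (interval N) (λ a → monomial (∣ a ∣ * ∣ a ∣) n)

  -- The operator U₇ of the theory of modular forms.
  U : Series → Series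
  U f n = f (7 * n)

  -- A factor q^(7e) passes through the operator as qᵉ; Fermat takes care of its sign.
  U-monomial-⊛ : ∀ e f n → (monomial (7 * e) ⊛ f) (7 * n) ≡₇ (monomial e ⊛ U f) n
  U-monomial-⊛ e f n = begin
    (monomial (7 * e) ⊛ f) (7 * n) % 7 ≡⟨ cong (_% 7) (monomial-⊛ (7 * e) f (7 * n)) ⟩
    (6 ^ (7 * e) * shift (7 * e) f (7 * n)) % 7
      ≡⟨ *-cong-≡₇ {6 ^ (7 * e)} {6 ^ e} (6^7n≡6^n e) (cong (_% 7) shift-U) ⟩
    (6 ^ e * shift e (U f) n) % 7 ≡⟨ cong (_% 7) (monomial-⊛ e (U f) n) ⟨
    (monomial e ⊛ U f) n % 7 ∎
    where
    open ≡-Reasoning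
    shift-U : shift (7 * e) f (7 * n) ≡ shift e (U f) n
    shift-U with e ≤? n
    ... | yes e≤n = begin
      shift (7 * e) f (7 * n) ≡⟨ cong (λ n → shift (7 * e) f (7 * n)) (m+[n∸m]≡n e≤n) ⟨
      shift (7 * e) f (7 * (e + (n ∸ e))) ≡⟨ cong (shift (7 * e) f) (*-distribˡ-+ 7 e (n ∸ e)) ⟩
      shift (7 * e) f (7 * e + 7 * (n ∸ e)) ≡⟨ shift-+ (7 * e) f _ ⟩
      U f (n ∸ e) ≡⟨ shift-+ e (U f) (n ∸ e) ⟨
      shift e (U f) (e + (n ∸ e)) ≡⟨ cong (shift e (U f)) (m+[n∸m]≡n e≤n) ⟩
      shift e (U f) n ∎
    ... | no e≰n = trans (shift-< f (*-monoʳ-< 7 (≰⇒> e≰n))) (sym (shift-< (U f) (≰⇒> e≰n)))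

  sq : ℤ → ℕ
  sq a = ∣ a ∣ * ∣ a ∣

  ∥_∥³ : ℤ × ℤ × ℤ → ℕ
  ∥ a , b , c ∥³ = sq a + (sq b + sq c)

  ∥_∥⁴ : ℤ × ℤ × ℤ × ℤ → ℕ
  ∥ a , b , c , d ∥⁴ = sq a + (sq b + (sq c + sq d))

  module _ (N : ℕ) where

    box³ : List (ℤ × ℤ × ℤ)
    box³ = cartesianProduct (interval N) (cartesianProduct (interval N) (interval N))

    box⁴ : List (ℤ × ℤ × ℤ × ℤ)
    box⁴ = cartesianProduct (interval N) box³

    -- For n ≤ N this lists every representation of n by three squares, since each coordinate is
    -- bounded by its square.
    sphere³ : ℕ → List (ℤ × ℤ × ℤ)
    sphere³ n = filter (λ v → ∥ v ∥³ ≟ n) box³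

    sphere⁴ : ℕ → List (ℤ × ℤ × ℤ × ℤ)
    sphere⁴ n = filter (λ v → ∥ v ∥⁴ ≟ n) box⁴

  module SeriesMod7 (N : ℕ) where

    open CommutativeSemiring (seriesSemiring N) public
      using (_≈_; semiring; setoid; reflexive; +-congˡ; *-cong; *-congˡ; *-congʳ)
      renaming (trans to ≈-trans; sym to ≈-sym)
    open Exp semiring using () renaming (_^_ to _^ₛ_) public
    7×1≈0 : HasCharacteristic7 (seriesSemiring N)
    7×1≈0 = coefficients λ { zero _ → refl ; (suc n) _ → refl }

    open Characteristic7 (seriesSemiring N) 7×1≈0 public

    open import Relation.Binary.Reasoning.Setoid setoid

    sum≗∑ : ∀ {a} {A : Set a} (as : List A) F → sum as F ≗ (λ n → ∑ as (λ a → F a n))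
    sum≗∑ [] F n = refl
    sum≗∑ (a ∷ as) F n = cong (F a n +_) (sum≗∑ as F n)

    X : Series
    X = shift 1 𝟙

    X^≗shift : ∀ e → X ^ₛ e ≗ shift e 𝟙
    X^≗shift zero n = refl
    X^≗shift (suc e) n = trans (shift-𝟙-⊛ 1 (X ^ₛ e) n)
      (trans (shift-cong 1 (X^≗shift e) n) (shift-∘ 1 e 𝟙 n))

    -- Truncation is what supplies the nilpotence that Gauss's identity was proved under.
    X^1+N≈0 : X ^ₛ suc N ≈ 𝟘
    X^1+N≈0 = ≈-trans (≗⇒≈ (X^≗shift (suc N)))
      (coefficients λ n n≤N → cong (_% 7) (shift-< 𝟙 (s≤s n≤N)))

    ovParts-zero-≈ : ovParts 0 ≈ 𝟙
    ovParts-zero-≈ = coefficients λ { zero _ → refl ; (suc n) _ → refl }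

    ovParts-suc-≈ : ∀ k → ovParts (suc k) ≈ ovParts k ⊕ X ^ₛ suc k ⊛ (ovParts (suc k) ⊕ ovParts k)
    ovParts-suc-≈ k = ≈-trans (≗⇒≈ (ovParts-suc k)) (+-congˡ (≈-sym
      (≈-trans (*-congʳ {ovParts (suc k) ⊕ ovParts k} (≗⇒≈ (X^≗shift (suc k))))
        (≗⇒≈ (shift-𝟙-⊛ (suc k) (ovParts (suc k) ⊕ ovParts k))))))

    open Gauss X ovParts ovParts-zero-≈ ovParts-suc-≈
      using (A*theta≈1; theta≈sum) renaming (theta to gaussTheta)

    -X≈monomial : -1# ⊛ X ≈ monomial 1
    -X≈monomial = ≈-trans (*-congʳ {X} (≗⇒≈ -1≗6)) (≗⇒≈ (λ n → trans (⊙-⊛-assoc 6 𝟙 X n) (cong (6 *_) (⊛-identityˡ X n))))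
      where
      -1≗6 : -1# ≗ 6 ⊙ 𝟙
      -1≗6 n = trans (⊛-distribʳ-⊕ (𝟙 ⊕ 𝟙 ⊕ 𝟙) 𝟙 𝟙 n)
        (trans (cong₂ _+_ (⊛-identityˡ (𝟙 ⊕ 𝟙 ⊕ 𝟙) n) (⊛-identityˡ (𝟙 ⊕ 𝟙 ⊕ 𝟙) n)) (six (𝟙 n)))
        where
        open +-*-Solver
        six : ∀ a → (a + a + a) + (a + a + a) ≡ 6 * a
        six = solve 1 (λ a → (a :+ a :+ a) :+ (a :+ a :+ a) := con 6 :* a) refl

    monomial-^ : ∀ d e → monomial d ^ₛ e ≈ monomial (e * d)
    monomial-^ d zero = coefficients λ { zero _ → refl ; (suc n) _ → refl }
    monomial-^ d (suc e) = ≈-trans (*-congˡ {monomial d} (monomial-^ d e)) (≗⇒≈ (monomial-+ d (e * d)))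

    theta≈sum-monomial : theta N ≈ sum (interval N) (λ a → monomial (sq a))
    theta≈sum-monomial = ≗⇒≈ (λ n → sym (sum≗∑ (interval N) (λ a → monomial (sq a)) n))

    -- Through degree N only parts of size at most N matter, so `pbar` may be exchanged for the
    -- finite product `ovParts N`.
    pbar*theta≈1 : pbar ⊛ theta N ≈ 𝟙
    pbar*theta≈1 = begin
      pbar ⊛ theta N
        ≈⟨ *-cong {pbar} {ovParts N} (coefficients λ n n≤N → cong (_% 7) (sym (ovParts≡pbar (≤⇒≤′ n≤N)))) theta≈sum-monomial ⟩
      ovParts N ⊛ sum (interval N) (λ a → monomial (sq a))
        ≈⟨ *-congˡ {ovParts N} (sum-cong (interval N) (λ a → power (sq a))) ⟨
      ovParts N ⊛ sum (interval N) (λ a → (-1# ⊛ X) ^ₛ sq a)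
        ≈⟨ *-congˡ {ovParts N} (theta≈sum N) ⟨
      ovParts N ⊛ gaussTheta N
        ≈⟨ A*theta≈1 N X^1+N≈0 ⟩
      𝟙 ∎
      where
      power : ∀ e → (-1# ⊛ X) ^ₛ e ≈ monomial e
      power e = ≈-trans (Exp.^-congˡ semiring e -X≈monomial)
        (≈-trans (monomial-^ 1 e) (reflexive (cong monomial (*-identityʳ e))))

    theta^7≈sum : theta N ^ₛ 7 ≈ sum (interval N) (λ a → monomial (7 * sq a))
    theta^7≈sum = ≈-trans (Exp.^-congˡ semiring 7 theta≈sum-monomial)
      (≈-trans (frobenius-sum (interval N) _) (sum-cong (interval N) (λ a → monomial-^ (sq a) 7)))

    sum-monomial-× : ∀ {a b} {A : Set a} {B : Set b} as bs (d : A → ℕ) (e : B → ℕ) →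
      sum as (λ a → monomial (d a)) ⊛ sum bs (λ b → monomial (e b)) ≈
      sum (cartesianProduct as bs) (λ (a , b) → monomial (d a + e b))
    sum-monomial-× as bs d e = ≈-trans
      (≈-sym (sum-cartesianProduct as bs (monomial ∘ d) (monomial ∘ e)))
      (sum-cong (cartesianProduct as bs) (λ (a , b) → ≗⇒≈ (monomial-+ (d a) (e b))))

    sum-monomial-length : ∀ {a} {A : Set a} (as : List A) (e : A → ℕ) →
      sum as (λ a → monomial (e a)) ≈ (λ n → 6 ^ n * length (filter (λ a → e a ≟ n) as))
    sum-monomial-length as e = ≗⇒≈ λ n →
      trans (sum≗∑ as (λ a → monomial (e a)) n) (∑-monomial as e n)

    private
      I = interval N
      ϑ = sum I (λ a → monomial (sq a))

      theta³≈sum : theta N ⊛ (theta N ⊛ theta N) ≈ sum (box³ N) (λ v → monomial ∥ v ∥³)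
      theta³≈sum = begin
        theta N ⊛ (theta N ⊛ theta N)
          ≈⟨ *-cong θ≈ϑ (*-cong θ≈ϑ θ≈ϑ) ⟩
        ϑ ⊛ (ϑ ⊛ ϑ)
          ≈⟨ *-congˡ {ϑ} (sum-monomial-× I I sq sq) ⟩
        ϑ ⊛ sum (cartesianProduct I I) (λ (b , c) → monomial (sq b + sq c))
          ≈⟨ sum-monomial-× I (cartesianProduct I I) sq (λ (b , c) → sq b + sq c) ⟩
        sum (box³ N) (λ v → monomial ∥ v ∥³) ∎
        where θ≈ϑ = theta≈sum-monomial

    theta³ : theta N ⊛ (theta N ⊛ theta N) ≈ (λ n → 6 ^ n * length (sphere³ N n))
    theta³ = ≈-trans theta³≈sum (sum-monomial-length (box³ N) ∥_∥³)

    theta⁴ : theta N ⊛ (theta N ⊛ (theta N ⊛ theta N)) ≈ (λ n → 6 ^ n * length (sphere⁴ N n))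
    theta⁴ = begin
      theta N ⊛ (theta N ⊛ (theta N ⊛ theta N))
        ≈⟨ *-cong theta≈sum-monomial theta³≈sum ⟩
      ϑ ⊛ sum (box³ N) (λ v → monomial ∥ v ∥³)
        ≈⟨ sum-monomial-× I (box³ N) sq ∥_∥³ ⟩
      sum (box⁴ N) (λ v → monomial ∥ v ∥⁴)
        ≈⟨ sum-monomial-length (box⁴ N) ∥_∥⁴ ⟩
      (λ n → 6 ^ n * length (sphere⁴ N n)) ∎

  -- The second factor is φ(-q⁷), a series in q⁷, and therefore leaves the operator as φ(-q).
  U-⊛-sum : ∀ N f n → (f ⊛ (λ m → ∑ (interval N) (λ a → monomial (7 * sq a) m))) (7 * n) ≡₇ (U f ⊛ theta N) n
  U-⊛-sum N f n = begin
    (f ⊛ Θ⁷) (7 * n) % 7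
      ≡⟨ cong (_% 7) (trans (⊛-comm f Θ⁷ (7 * n)) (∑-⊛ I (λ a → monomial (7 * sq a)) f (7 * n))) ⟩
    ∑ I (λ a → (monomial (7 * sq a) ⊛ f) (7 * n)) % 7
      ≡⟨ ∑-cong I (λ a → U-monomial-⊛ (sq a) f n) ⟩
    ∑ I (λ a → (monomial (sq a) ⊛ U f) n) % 7
      ≡⟨ cong (_% 7) (trans (⊛-comm (U f) (theta N) n) (∑-⊛ I (λ a → monomial (sq a)) (U f) n)) ⟨
    (U f ⊛ theta N) n % 7 ∎
    where
    open ≡-Reasoning
    I = interval N
    Θ⁷ = λ m → ∑ I (λ a → monomial (7 * sq a) m)

  pbar3-7n : ∀ M → (∀ n → n ≤ M → length (sphere⁴ (7 * M) (7 * n)) ≡₇ length (sphere⁴ (7 * M) n)) →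
             ∀ n → n ≤ M → pbar3 (7 * n) ≡₇ 6 ^ n * length (sphere³ (7 * M) n)
  pbar3-7n M sphere⁴-7n n n≤M =
    trans (cong (_% 7) (pbar3≗pbar³ (7 * n))) (coefficient
      (M.≈-trans (M.cb≈b⁴⇒c≈b³ {pbar} {θ} {U P³} (≈-mono M≤N N.pbar*theta≈1) UP³θ≈θ⁴)
        (≈-mono M≤N N.theta³)) n n≤M)
    where
    -- Coefficient n after extraction is coefficient 7n before it, so precision M afterwards
    -- requires precision 7M at the start.
    N = 7 * M
    M≤N = m≤n*m M 7
    module N = SeriesMod7 N
    module M = SeriesMod7 M
    θ = theta N
    P³ = pbar ⊛ (pbar ⊛ pbar)

    P³θ⁷≈θ⁴ : P³ ⊛ (λ m → ∑ (interval N) (λ a → monomial (7 * sq a) m)) ≈[ N ] θ ⊛ (θ ⊛ (θ ⊛ θ))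
    P³θ⁷≈θ⁴ = N.≈-trans
      (N.*-congˡ {P³} (N.≈-sym (N.≈-trans N.theta^7≈sum (≗⇒≈ (N.sum≗∑ (interval N) (λ a → monomial (7 * sq a)))))))
      (N.[ab]³b⁴≈b⁴ {pbar} {θ} N.pbar*theta≈1)

    UP³θ≈θ⁴ : U P³ ⊛ θ ≈[ M ] θ ⊛ (θ ⊛ (θ ⊛ θ))
    UP³θ≈θ⁴ = coefficients λ n n≤M → begin
      (U P³ ⊛ θ) n % 7
        ≡⟨ U-⊛-sum N P³ n ⟨
      (P³ ⊛ (λ m → ∑ (interval N) (λ a → monomial (7 * sq a) m))) (7 * n) % 7
        ≡⟨ coefficient P³θ⁷≈θ⁴ (7 * n) (*-monoʳ-≤ 7 n≤M) ⟩
      (θ ⊛ (θ ⊛ (θ ⊛ θ))) (7 * n) % 7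
        ≡⟨ coefficient N.theta⁴ (7 * n) (*-monoʳ-≤ 7 n≤M) ⟩
      6 ^ (7 * n) * length (sphere⁴ N (7 * n)) % 7
        ≡⟨ *-cong-≡₇ {6 ^ (7 * n)} {6 ^ n} (6^7n≡6^n n) (sphere⁴-7n n n≤M) ⟩
      6 ^ n * length (sphere⁴ N n) % 7
        ≡⟨ coefficient N.theta⁴ n (≤-trans n≤M M≤N) ⟨
      (θ ⊛ (θ ⊛ (θ ⊛ θ))) n % 7 ∎
      where open ≡-Reasoning

-- Counting lattice points in spheres by similitudes.

module Counting where

  open import Data.Bool using (if_then_else_)
  open import Data.Integer using (+_; -[1+_]; ∣_∣)
  open import Data.List using (List; []; _∷_; length; filter; map)
  open import Data.List.Membership.Propositional using (_∈_)
  open import Data.List.Membership.Propositional.Properties using (∈-filter⁺; ∈-filter⁻; ∈-map⁺; ∈-map⁻; ∈-cartesianProduct⁺)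
  open import Data.List.Membership.Propositional.Properties.WithK using (unique∧set⇒bag)
  open import Data.List.Properties using (length-map)
  open import Data.List.Relation.Binary.BagAndSetEquality using (∼bag⇒↭)
  open import Data.List.Relation.Binary.Permutation.Propositional.Properties using (↭-length)
  open import Data.List.Relation.Unary.All as All using (All; []; _∷_)
  open import Data.List.Relation.Unary.Any using (here; there)
  open import Data.List.Relation.Unary.Unique.Propositional using (Unique; []; _∷_)
  import Data.List.Relation.Unary.Unique.Propositional.Properties as Unique
  open import Data.Nat
  open import Data.Nat.DivMod using ([m+kn]%n≡m%n; m*n%n≡0)
  open import Data.Nat.Properties
  open import Data.Nat.Solver using (module +-*-Solver)
  open import Data.Product using (∃; _,_; proj₂)
  open import Data.Sum using (inj₁; inj₂)
  open import Function using (_∘_; mk⇔)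
  open import Level using (0ℓ)
  open import Relation.Binary.PropositionalEquality
  open import Relation.Nullary using (¬_; yes; no; does)
  open import Relation.Nullary.Decidable using (dec-true; dec-false)
  open import Relation.Unary using (Pred; Decidable)

  open CharacteristicSeven
  open PowerSeries
  open Overpartitions

  interval-bounded : ∀ N → All (λ a → ∣ a ∣ ≤ N) (interval N)
  interval-bounded zero = z≤n ∷ []
  interval-bounded (suc N) = ≤-refl ∷ ≤-refl ∷ All.map m≤n⇒m≤1+n (interval-bounded N)

  interval-unique : ∀ N → Unique (interval N)
  interval-unique zero = [] ∷ []
  interval-unique (suc N) =
    ((λ ()) ∷ outside ≤-refl) ∷ outside ≤-refl ∷ interval-unique N
    where
    outside : ∀ {a} → N < ∣ a ∣ → All (a ≢_) (interval N)
    outside N<∣a∣ = All.map (λ { ∣a∣≤N refl → <⇒≱ N<∣a∣ ∣a∣≤N }) (interval-bounded N)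

  ∈-interval : ∀ {a} N → ∣ a ∣ ≤ N → a ∈ interval N
  ∈-interval {+ zero} zero _ = here refl
  ∈-interval {a} (suc N) ∣a∣≤1+N with m≤n⇒m<n∨m≡n ∣a∣≤1+N
  ... | inj₁ (s≤s ∣a∣≤N) = there (there (∈-interval N ∣a∣≤N))
  ∈-interval {+ suc N} (suc N) _ | inj₂ refl = here refl
  ∈-interval { -[1+ N ]} (suc N) _ | inj₂ refl = there (here refl)

  sq≤⇒∈-interval : ∀ {a N} → sq a ≤ N → a ∈ interval N
  sq≤⇒∈-interval {a} {N} a²≤N = ∈-interval N (≤-trans (n≤n*n ∣ a ∣) a²≤N)
    where
    n≤n*n : ∀ n → n ≤ n * n
    n≤n*n zero = z≤n
    n≤n*n n@(suc _) = m≤m*n n n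

  box³-unique : ∀ N → Unique (box³ N)
  box³-unique N = Unique.cartesianProduct⁺ (interval-unique N)
    (Unique.cartesianProduct⁺ (interval-unique N) (interval-unique N))

  ∈-box³ : ∀ {N v} → ∥ v ∥³ ≤ N → v ∈ box³ N
  ∈-box³ {v = a , b , c} v≤N = ∈-cartesianProduct⁺ (sq≤⇒∈-interval (m+n≤o⇒m≤o (sq a) v≤N))
    (∈-cartesianProduct⁺ (sq≤⇒∈-interval (m+n≤o⇒m≤o (sq b) b²+c²≤N)) (sq≤⇒∈-interval (m+n≤o⇒n≤o (sq b) b²+c²≤N)))
    where b²+c²≤N = m+n≤o⇒n≤o (sq a) v≤N

  box⁴-unique : ∀ N → Unique (box⁴ N)
  box⁴-unique N = Unique.cartesianProduct⁺ (interval-unique N) (box³-unique N)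

  ∈-box⁴ : ∀ {N v} → ∥ v ∥⁴ ≤ N → v ∈ box⁴ N
  ∈-box⁴ {v = a , v} v≤N =
    ∈-cartesianProduct⁺ (sq≤⇒∈-interval (m+n≤o⇒m≤o (sq a) v≤N)) (∈-box³ (m+n≤o⇒n≤o (sq a) v≤N))

  module _ {a} {A : Set a} where

    ∑-cong-∈ : ∀ as {f g : A → ℕ} → (∀ {a} → a ∈ as → f a ≡₇ g a) → ∑ as f ≡₇ ∑ as g
    ∑-cong-∈ [] f≡g = refl
    ∑-cong-∈ (a ∷ as) {f} {g} f≡g = +-cong-≡₇ {f a} {g a} (f≡g (here refl)) (∑-cong-∈ as (f≡g ∘ there))

    ∑-1 : ∀ (as : List A) → ∑ as (λ _ → 1) ≡ length as
    ∑-1 [] = refl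
    ∑-1 (a ∷ as) = cong suc (∑-1 as)

    ∑-const-∈ : ∀ as {f : A → ℕ} {c} → (∀ {a} → a ∈ as → f a ≡ c) → ∑ as f ≡ length as * c
    ∑-const-∈ [] f≡c = refl
    ∑-const-∈ (a ∷ as) f≡c = cong₂ _+_ (f≡c (here refl)) (∑-const-∈ as (f≡c ∘ there))

    ∑-+ : ∀ as (f g : A → ℕ) → ∑ as (λ a → f a + g a) ≡ ∑ as f + ∑ as g
    ∑-+ [] f g = refl
    ∑-+ (a ∷ as) f g = trans (cong (λ s → f a + g a + s) (∑-+ as f g))
      (solve 4 (λ a b c d → (a :+ b) :+ (c :+ d) := (a :+ c) :+ (b :+ d)) refl
        (f a) (g a) (∑ as f) (∑ as g))
      where open +-*-Solver

    ∑-*ˡ : ∀ as c (f : A → ℕ) → ∑ as (λ a → c * f a) ≡ c * ∑ as f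
    ∑-*ˡ [] c f = sym (*-zeroʳ c)
    ∑-*ˡ (a ∷ as) c f = trans (cong (λ s → c * f a + s) (∑-*ˡ as c f)) (sym (*-distribˡ-+ c (f a) (∑ as f)))

    ∑-0 : ∀ (as : List A) → ∑ as (λ _ → 0) ≡ 0
    ∑-0 [] = refl
    ∑-0 (a ∷ as) = ∑-0 as

    indicator : ∀ {P : Pred A 0ℓ} → Decidable P → A → ℕ
    indicator P? a = if does (P? a) then 1 else 0

    indicator-yes : ∀ {P : Pred A 0ℓ} (P? : Decidable P) {a} → P a → indicator P? a ≡ 1
    indicator-yes P? {a} p = cong (λ b → if b then 1 else 0) (dec-true (P? a) p)

    indicator-no : ∀ {P : Pred A 0ℓ} (P? : Decidable P) {a} → ¬ P a → indicator P? a ≡ 0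
    indicator-no P? {a} ¬p = cong (λ b → if b then 1 else 0) (dec-false (P? a) ¬p)

    length-filter≡∑ : ∀ {P : Pred A 0ℓ} (P? : Decidable P) as →
                      length (filter P? as) ≡ ∑ as (indicator P?)
    length-filter≡∑ P? [] = refl
    length-filter≡∑ P? (a ∷ as) with P? a
    ... | yes p = cong suc (length-filter≡∑ P? as)
    ... | no ¬p = length-filter≡∑ P? as

  ∑-comm : ∀ {a b} {A : Set a} {B : Set b} as bs (f : A → B → ℕ) →
           ∑ as (λ a → ∑ bs (f a)) ≡ ∑ bs (λ b → ∑ as (λ a → f a b))
  ∑-comm [] bs f = sym (∑-0 bs)
  ∑-comm (a ∷ as) bs f = trans (cong (λ s → ∑ bs (f a) + s) (∑-comm as bs f)) (sym (∑-+ bs (f a) _))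

  ∑-length-filter-comm : ∀ {a b} {A : Set a} {B : Set b} {P : A → Pred B 0ℓ} (P? : ∀ a → Decidable (P a)) as bs →
    ∑ as (λ a → length (filter (P? a) bs)) ≡ ∑ bs (λ b → length (filter (λ a → P? a b) as))
  ∑-length-filter-comm P? as bs = begin
    ∑ as (λ a → length (filter (P? a) bs))
      ≡⟨ ∑-≗ as (λ a → length-filter≡∑ (P? a) bs) ⟩
    ∑ as (λ a → ∑ bs (indicator (P? a)))
      ≡⟨ ∑-comm as bs (λ a → indicator (P? a)) ⟩
    ∑ bs (λ b → ∑ as (λ a → indicator (P? a) b))
      ≡⟨ ∑-≗ bs (λ b → length-filter≡∑ (λ a → P? a b) as) ⟨
    ∑ bs (λ b → length (filter (λ a → P? a b) as)) ∎
    where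
    open ≡-Reasoning
    ∑-≗ : ∀ {c} {C : Set c} cs {f g : C → ℕ} → f ≗ g → ∑ cs f ≡ ∑ cs g
    ∑-≗ [] f≗g = refl
    ∑-≗ (c ∷ cs) f≗g = cong₂ _+_ (f≗g c) (∑-≗ cs f≗g)

  module Similitudes {V : Set} (∥_∥ : V → ℕ) {N : ℕ} (box : List V)
    (box-unique : Unique box) (∈-box : ∀ {v} → ∥ v ∥ ≤ N → v ∈ box) where

    sphere : ℕ → List V
    sphere n = filter (λ v → ∥ v ∥ ≟ n) box

    ∈-sphere : ∀ {n v} → v ∈ sphere n → ∥ v ∥ ≡ n
    ∈-sphere {n} v∈S = proj₂ (∈-filter⁻ (λ v → ∥ v ∥ ≟ n) {xs = box} v∈S)

    -- The list of the v with P v and the image under g of the smaller sphere are both free of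
    -- repetitions and have the same members, hence the same length. The bound k n ≤ N keeps both
    -- spheres inside the box.
    sphere-image : ∀ k n .{{_ : NonZero k}} → k * n ≤ N →
      (g : V → V) → (∀ {v w} → g v ≡ g w → v ≡ w) → (∀ w → ∥ g w ∥ ≡ k * ∥ w ∥) →
      {P : Pred V 0ℓ} (P? : Decidable P) → (∀ w → P (g w)) → (∀ {v} → P v → ∃ λ w → g w ≡ v) →
      length (filter P? (sphere (k * n))) ≡ length (sphere n)
    sphere-image k n kn≤N g g-injective ∥g∥ {P} P? P-g P⇒g = begin
      length (filter P? (sphere (k * n)))
        ≡⟨ ↭-length (∼bag⇒↭ (unique∧set⇒bag
             (Unique.filter⁺ P? (Unique.filter⁺ (λ v → ∥ v ∥ ≟ k * n) box-unique))
             (Unique.map⁺ g-injective (Unique.filter⁺ (λ v → ∥ v ∥ ≟ n) box-unique))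
             (mk⇔ to from))) ⟩
      length (map g (sphere n))
        ≡⟨ length-map g (sphere n) ⟩
      length (sphere n) ∎
      where
      open ≡-Reasoning

      to : ∀ {v} → v ∈ filter P? (sphere (k * n)) → v ∈ map g (sphere n)
      to v∈ with v∈S , Pv ← ∈-filter⁻ P? v∈ with P⇒g Pv
      ... | w , refl = ∈-map⁺ g (∈-filter⁺ (λ v → ∥ v ∥ ≟ n)
          (∈-box (≤-trans (≤-reflexive ∥w∥≡n) (≤-trans (m≤n*m n k) kn≤N))) ∥w∥≡n)
        where
        ∥w∥≡n : ∥ w ∥ ≡ n
        ∥w∥≡n = *-cancelˡ-≡ ∥ w ∥ n k (trans (sym (∥g∥ w)) (∈-sphere v∈S))

      from : ∀ {v} → v ∈ map g (sphere n) → v ∈ filter P? (sphere (k * n))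
      from v∈ with w , w∈S , refl ← ∈-map⁻ g v∈ =
        ∈-filter⁺ P? (∈-filter⁺ (λ v → ∥ v ∥ ≟ k * n) (∈-box (≤-trans (≤-reflexive ∥gw∥≡kn) kn≤N)) ∥gw∥≡kn) (P-g w)
        where
        ∥gw∥≡kn : ∥ g w ∥ ≡ k * n
        ∥gw∥≡kn = trans (∥g∥ w) (cong (k *_) (∈-sphere w∈S))

    -- The pairs (a, v) with P a v, counted first by a and then by v.
    sphere-double-count : ∀ k n {A : Set} (as : List A) {P : A → Pred V 0ℓ} (P? : ∀ a → Decidable (P a)) →
      (∀ {a} → a ∈ as → length (filter (P? a) (sphere (k * n))) ≡ length (sphere n)) →
      length as * length (sphere n) ≡ ∑ (sphere (k * n)) (λ v → length (filter (λ a → P? a v) as))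
    sphere-double-count k n as P? image = trans (sym (∑-const-∈ as image))
      (∑-length-filter-comm P? as (sphere (k * n)))

  8m≡m : ∀ m → 8 * m ≡₇ m
  8m≡m m = trans (cong (λ k → (m + k) % 7) (*-comm 7 m)) ([m+kn]%n≡m%n m m 7)

  -- Cancellation of n without subtraction: add 6n to both sides. The factor 1 is the value of k in
  -- `sphere³-hecke`.
  m+1n≡₇n⇒m≡₇0 : ∀ m n → m + 1 * n ≡₇ n → m ≡₇ 0
  m+1n≡₇n⇒m≡₇0 m n m+1n≡n = begin
    m % 7 ≡⟨ [m+kn]%n≡m%n m n 7 ⟨
    (m + n * 7) % 7
      ≡⟨ cong (_% 7) (solve 2 (λ m n → m :+ n :* con 7 := (m :+ con 1 :* n) :+ con 6 :* n) refl m n) ⟩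
    (m + 1 * n + 6 * n) % 7 ≡⟨ +-cong-≡₇ {m + 1 * n} {n} m+1n≡n refl ⟩
    (n + 6 * n) % 7 ≡⟨ cong (_% 7) (*-comm 7 n) ⟩
    (n * 7) % 7 ≡⟨ m*n%n≡0 n 7 ⟩
    0 ∎
    where
    open ≡-Reasoning
    open +-*-Solver

-- Quaternions of norm 7 and the congruences for r₄ and r₃.

module Quaternions where

  open import Data.Fin as Fin using (Fin; toℕ; fromℕ<)
  import Data.Fin.Properties as Fin
  open import Data.Integer as ℤ using (ℤ; +_; -[1+_])
  open import Data.Integer.DivMod using (_%ℕ_; _/ℕ_; n%ℕd<d; a≡a%ℕn+[a/ℕn]*n)
  open import Data.Integer.Divisibility.Signed
    using (_∣_; divides; _∣?_; ∣-refl; ∣-trans; ∣m∣n⇒∣m+n; ∣m+n∣n⇒∣m; ∣m⇒∣m*n; *-cancelˡ-∣; *-monoʳ-∣)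
  import Data.Integer.Properties as ℤ
  import Data.Integer.Solver as ℤSolver
  open import Data.List using (List; []; _∷_; length; filter; cartesianProduct)
  open import Data.List.Membership.Propositional using (_∈_)
  open import Data.List.Properties using (filter-≐)
  open import Data.List.Relation.Unary.All as All using (All)
  open import Data.List.Relation.Unary.Any using (here; there)
  open import Data.Nat as ℕ using (ℕ; suc; _≤_; _%_)
  import Data.Nat.Properties as ℕ
  open import Data.Product using (∃; ∃₂; _×_; _,_; proj₁; proj₂)
  open import Function using (_∘_)
  open import Relation.Binary.PropositionalEquality hiding ([_])
  open import Relation.Nullary using (Dec; ¬_; ¬?; _×-dec_; _→-dec_; yes; no; contradiction)
  open import Relation.Nullary.Decidable using (from-yes)
  open import Relation.Unary using (Decidable)

  open CharacteristicSeven
  open PowerSeries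
  open Overpartitions
  open Counting

  -- The operations are parameters so that one set of formulas serves both for integers and for the
  -- polynomials of the ring solver.
  module Quaternion {A : Set} (_+_ _*_ : A → A → A) (-_ : A → A) where

    dot³ : A × A × A → A × A × A → A
    dot³ (x , y , z) (x′ , y′ , z′) = (x * x′) + ((y * y′) + (z * z′))

    dot⁴ : A × A × A × A → A × A × A × A → A
    dot⁴ (w , v) (w′ , v′) = (w * w′) + dot³ v v′

    scale³ : A → A × A × A → A × A × A
    scale³ m (x , y , z) = m * x , m * y , m * z

    scale⁴ : A → A × A × A × A → A × A × A × A
    scale⁴ m (w , v) = m * w , scale³ m v

    infixl 6 _+³_ _+⁴_

    _+³_ : A × A × A → A × A × A → A × A × A
    (x , y , z) +³ (x′ , y′ , z′) = x + x′ , y + y′ , z + z′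

    _+⁴_ : A × A × A × A → A × A × A × A → A × A × A × A
    (w , v) +⁴ (w′ , v′) = w + w′ , v +³ v′

    conj : A × A × A × A → A × A × A × A
    conj (a , b , c , d) = a , - b , - c , - d

    -- The rows of the matrix of v ↦ α v.
    left₁ left₂ left₃ left₄ : A × A × A × A → A × A × A × A
    left₁ (a , b , c , d) = a , - b , - c , - d
    left₂ (a , b , c , d) = b , a , - d , c
    left₃ (a , b , c , d) = c , d , a , - b
    left₄ (a , b , c , d) = d , - c , b , a

    left : A × A × A × A → A × A × A × A → A × A × A × A
    left α v = dot⁴ (left₁ α) v , dot⁴ (left₂ α) v , dot⁴ (left₃ α) v , dot⁴ (left₄ α) v

    private
      double : A → A
      double x = x + x

    -- The rows of the matrix of v ↦ α v ᾱ on the pure quaternions.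
    rotate₁ rotate₂ rotate₃ : A × A × A × A → A × A × A
    rotate₁ (a , b , c , d) =
      ((a * a) + (b * b)) + (- ((c * c) + (d * d))) , double ((b * c) + (- (a * d))) , double ((b * d) + (a * c))
    rotate₂ (a , b , c , d) =
      double ((b * c) + (a * d)) , ((a * a) + (c * c)) + (- ((b * b) + (d * d))) , double ((c * d) + (- (a * b)))
    rotate₃ (a , b , c , d) =
      double ((b * d) + (- (a * c))) , double ((c * d) + (a * b)) , ((a * a) + (d * d)) + (- ((b * b) + (c * c)))

    rotate : A × A × A × A → A × A × A → A × A × A
    rotate α v = dot³ (rotate₁ α) v , dot³ (rotate₂ α) v , dot³ (rotate₃ α) v

  open Quaternion ℤ._+_ ℤ._*_ ℤ.-_

  private
    open ℤSolver.+-*-Solver using (Polynomial; solve; con; _:+_; _:*_; :-_; _:=_)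
    module P {n} = Quaternion {Polynomial n} _:+_ _:*_ :-_

  ,-cong³ : ∀ {x y z x′ y′ z′ : ℤ} → x ≡ x′ → y ≡ y′ → z ≡ z′ → (x , y , z) ≡ (x′ , y′ , z′)
  ,-cong³ refl refl refl = refl

  conj-involutive : ∀ α → conj (conj α) ≡ α
  conj-involutive (a , b , c , d) =
    cong (a ,_) (,-cong³ (ℤ.neg-involutive b) (ℤ.neg-involutive c) (ℤ.neg-involutive d))

  dot⁴-conj : ∀ α → dot⁴ (conj α) (conj α) ≡ dot⁴ α α
  dot⁴-conj (a , b , c , d) =
    solve 4 (λ a b c d → let α = a , b , c , d in P.dot⁴ (P.conj α) (P.conj α) := P.dot⁴ α α) refl a b c d

  left-conj-left : ∀ α v → left (conj α) (left α v) ≡ scale⁴ (dot⁴ α α) v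
  left-conj-left (a , b , c , d) (w , x , y , z) = cong₂ _,_
    (solve 8 (λ a b c d w x y z → let α = a , b , c , d ; v = w , x , y , z in
      P.dot⁴ (P.left₁ (P.conj α)) (P.left α v) := P.dot⁴ α α :* w) refl a b c d w x y z)
    (,-cong³
      (solve 8 (λ a b c d w x y z → let α = a , b , c , d ; v = w , x , y , z in
        P.dot⁴ (P.left₂ (P.conj α)) (P.left α v) := P.dot⁴ α α :* x) refl a b c d w x y z)
      (solve 8 (λ a b c d w x y z → let α = a , b , c , d ; v = w , x , y , z in
        P.dot⁴ (P.left₃ (P.conj α)) (P.left α v) := P.dot⁴ α α :* y) refl a b c d w x y z)
      (solve 8 (λ a b c d w x y z → let α = a , b , c , d ; v = w , x , y , z in
        P.dot⁴ (P.left₄ (P.conj α)) (P.left α v) := P.dot⁴ α α :* z) refl a b c d w x y z))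

  -- Euler's four-square identity.
  dot⁴-left : ∀ α v → dot⁴ (left α v) (left α v) ≡ dot⁴ α α ℤ.* dot⁴ v v
  dot⁴-left (a , b , c , d) (w , x , y , z) =
    solve 8 (λ a b c d w x y z → let α = a , b , c , d ; v = w , x , y , z in
      P.dot⁴ (P.left α v) (P.left α v) := P.dot⁴ α α :* P.dot⁴ v v) refl a b c d w x y z

  rotate-conj-rotate : ∀ α v → rotate (conj α) (rotate α v) ≡ scale³ (dot⁴ α α ℤ.* dot⁴ α α) v
  rotate-conj-rotate (a , b , c , d) (x , y , z) = ,-cong³
    (solve 7 (λ a b c d x y z → let α = a , b , c , d ; v = x , y , z in
      P.dot³ (P.rotate₁ (P.conj α)) (P.rotate α v) := P.dot⁴ α α :* P.dot⁴ α α :* x) refl a b c d x y z)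
    (solve 7 (λ a b c d x y z → let α = a , b , c , d ; v = x , y , z in
      P.dot³ (P.rotate₂ (P.conj α)) (P.rotate α v) := P.dot⁴ α α :* P.dot⁴ α α :* y) refl a b c d x y z)
    (solve 7 (λ a b c d x y z → let α = a , b , c , d ; v = x , y , z in
      P.dot³ (P.rotate₃ (P.conj α)) (P.rotate α v) := P.dot⁴ α α :* P.dot⁴ α α :* z) refl a b c d x y z)

  dot³-rotate : ∀ α v → dot³ (rotate α v) (rotate α v) ≡ (dot⁴ α α ℤ.* dot⁴ α α) ℤ.* dot³ v v
  dot³-rotate (a , b , c , d) (x , y , z) =
    solve 7 (λ a b c d x y z → let α = a , b , c , d ; v = x , y , z in
      P.dot³ (P.rotate α v) (P.rotate α v) := P.dot⁴ α α :* P.dot⁴ α α :* P.dot³ v v) refl a b c d x y z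


  +sq : ∀ a → + sq a ≡ a ℤ.* a
  +sq (+ n) = ℤ.pos-* n n
  +sq -[1+ n ] = refl

  +∥∥³ : ∀ v → + ∥ v ∥³ ≡ dot³ v v
  +∥∥³ (a , b , c) = cong₂ ℤ._+_ (+sq a) (cong₂ ℤ._+_ (+sq b) (+sq c))

  +∥∥⁴ : ∀ v → + ∥ v ∥⁴ ≡ dot⁴ v v
  +∥∥⁴ (a , v) = cong₂ ℤ._+_ (+sq a) (+∥∥³ v)

  infix 4 _∣³_ _∣⁴_ _∣³?_ _∣⁴?_

  _∣³_ : ℤ → ℤ × ℤ × ℤ → Set
  m ∣³ (x , y , z) = m ∣ x × m ∣ y × m ∣ z

  _∣³?_ : ∀ m v → Dec (m ∣³ v)
  m ∣³? (x , y , z) = m ∣? x ×-dec m ∣? y ×-dec m ∣? z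

  _∣⁴_ : ℤ → ℤ × ℤ × ℤ × ℤ → Set
  m ∣⁴ (w , v) = m ∣ w × m ∣³ v

  _∣⁴?_ : ∀ m v → Dec (m ∣⁴ v)
  m ∣⁴? (w , v) = m ∣? w ×-dec m ∣³? v

  module _ {m : ℤ} where

    ∣-scale³ : ∀ v → m ∣³ scale³ m v
    ∣-scale³ (x , y , z) = ∣m⇒∣m*n x ∣-refl , ∣m⇒∣m*n y ∣-refl , ∣m⇒∣m*n z ∣-refl

    ∣-scale⁴ : ∀ v → m ∣⁴ scale⁴ m v
    ∣-scale⁴ (w , v) = ∣m⇒∣m*n w ∣-refl , ∣-scale³ v

    ∣³⇒scale : ∀ {v} → m ∣³ v → ∃ λ w → scale³ m w ≡ v
    ∣³⇒scale (divides x refl , divides y refl , divides z refl) =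
      (x , y , z) , ,-cong³ (ℤ.*-comm m x) (ℤ.*-comm m y) (ℤ.*-comm m z)

    ∣⁴⇒scale : ∀ {v} → m ∣⁴ v → ∃ λ w → scale⁴ m w ≡ v
    ∣⁴⇒scale (divides w refl , m∣v) =
      (w , proj₁ (∣³⇒scale m∣v)) , cong₂ _,_ (ℤ.*-comm m w) (proj₂ (∣³⇒scale m∣v))

    module _ {{_ : ℤ.NonZero m}} where

      scale³-injective : ∀ {v w} → scale³ m v ≡ scale³ m w → v ≡ w
      scale³-injective {x , y , z} {x′ , y′ , z′} eq = ,-cong³
        (ℤ.*-cancelˡ-≡ m x x′ (cong proj₁ eq))
        (ℤ.*-cancelˡ-≡ m y y′ (cong (λ v → proj₁ (proj₂ v)) eq))
        (ℤ.*-cancelˡ-≡ m z z′ (cong (λ v → proj₂ (proj₂ v)) eq))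

      scale⁴-injective : ∀ {v w} → scale⁴ m v ≡ scale⁴ m w → v ≡ w
      scale⁴-injective {w , _} {w′ , _} eq = cong₂ _,_
        (ℤ.*-cancelˡ-≡ m w w′ (cong proj₁ eq)) (scale³-injective (cong proj₂ eq))

  residue : ∀ t → ∃₂ λ (i : Fin 7) q → + toℕ i ℤ.+ + 7 ℤ.* q ≡ t
  residue t = fromℕ< (n%ℕd<d t 7) , t /ℕ 7 , (begin
    + toℕ (fromℕ< (n%ℕd<d t 7)) ℤ.+ + 7 ℤ.* (t /ℕ 7)
      ≡⟨ cong₂ (λ r s → + r ℤ.+ s) (Fin.toℕ-fromℕ< (n%ℕd<d t 7)) (ℤ.*-comm (+ 7) (t /ℕ 7)) ⟩
    + (t %ℕ 7) ℤ.+ (t /ℕ 7) ℤ.* + 7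
      ≡⟨ a≡a%ℕn+[a/ℕn]*n t 7 ⟨
    t ∎)
    where open ≡-Reasoning

  [_,_,_] : Fin 7 → Fin 7 → Fin 7 → ℤ × ℤ × ℤ
  [ i , j , k ] = + toℕ i , + toℕ j , + toℕ k

  residue³ : ∀ v → ∃₂ λ i j → ∃₂ λ k q → [ i , j , k ] +³ scale³ (+ 7) q ≡ v
  residue³ (x , y , z) with i , p , refl ← residue x | j , q , refl ← residue y | k , r , refl ← residue z =
    i , j , k , (p , q , r) , refl

  dot³-mod-7 : ∀ r x y → dot³ r (x +³ scale³ (+ 7) y) ≡ dot³ r x ℤ.+ + 7 ℤ.* dot³ r y
  dot³-mod-7 (r₁ , r₂ , r₃) (x₁ , x₂ , x₃) (y₁ , y₂ , y₃) =
    solve 9 (λ r₁ r₂ r₃ x₁ x₂ x₃ y₁ y₂ y₃ → let r = r₁ , r₂ , r₃ ; x = x₁ , x₂ , x₃ ; y = y₁ , y₂ , y₃ in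
      P.dot³ r (x P.+³ P.scale³ (con (+ 7)) y) := P.dot³ r x :+ con (+ 7) :* P.dot³ r y)
      refl r₁ r₂ r₃ x₁ x₂ x₃ y₁ y₂ y₃

  dot⁴-mod-7 : ∀ r x y → dot⁴ r (x +⁴ scale⁴ (+ 7) y) ≡ dot⁴ r x ℤ.+ + 7 ℤ.* dot⁴ r y
  dot⁴-mod-7 (r₁ , r) (x₁ , x) (y₁ , y) = trans
    (cong (λ e → r₁ ℤ.* (x₁ ℤ.+ + 7 ℤ.* y₁) ℤ.+ e) (dot³-mod-7 r x y))
    (solve 5 (λ r x y s t → r :* (x :+ con (+ 7) :* y) :+ (s :+ con (+ 7) :* t) :=
       (r :* x :+ s) :+ con (+ 7) :* (r :* y :+ t)) refl r₁ x₁ y₁ (dot³ r x) (dot³ r y))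

  -- The witness comes from (x + 7y)·(x + 7y) - x·x = 7 (2x + 7y)·y.
  dot³-square-mod-7 : ∀ x y → ∃ λ t → dot³ (x +³ scale³ (+ 7) y) (x +³ scale³ (+ 7) y) ≡ dot³ x x ℤ.+ + 7 ℤ.* t
  dot³-square-mod-7 x@(x₁ , x₂ , x₃) y@(y₁ , y₂ , y₃) = dot³ (x +³ (x +³ scale³ (+ 7) y)) y ,
    solve 6 (λ x₁ x₂ x₃ y₁ y₂ y₃ → let x = x₁ , x₂ , x₃ ; y = y₁ , y₂ , y₃ ; v = x P.+³ P.scale³ (con (+ 7)) y in
      P.dot³ v v := P.dot³ x x :+ con (+ 7) :* P.dot³ (x P.+³ v) y)
      refl x₁ x₂ x₃ y₁ y₂ y₃

  dot⁴-square-mod-7 : ∀ x y → ∃ λ t → dot⁴ (x +⁴ scale⁴ (+ 7) y) (x +⁴ scale⁴ (+ 7) y) ≡ dot⁴ x x ℤ.+ + 7 ℤ.* t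
  dot⁴-square-mod-7 (x₁ , x) (y₁ , y) = v ℤ.* y₁ ℤ.+ t , trans
    (cong (λ e → u ℤ.* u ℤ.+ e) (proj₂ (dot³-square-mod-7 x y)))
    (solve 4 (λ x y s t → (x :+ con (+ 7) :* y) :* (x :+ con (+ 7) :* y) :+ (s :+ con (+ 7) :* t) :=
       (x :* x :+ s) :+ con (+ 7) :* ((x :+ (x :+ con (+ 7) :* y)) :* y :+ t)) refl x₁ y₁ (dot³ x x) t)
    where
    t = proj₁ (dot³-square-mod-7 x y)
    u = x₁ ℤ.+ + 7 ℤ.* y₁
    v = x₁ ℤ.+ u

  module _ {s s′ t : ℤ} (eq : s ≡ s′ ℤ.+ + 7 ℤ.* t) where

    7∣-mod-7⇒ : + 7 ∣ s → + 7 ∣ s′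
    7∣-mod-7⇒ 7∣s = ∣m+n∣n⇒∣m (subst (+ 7 ∣_) eq 7∣s) (∣m⇒∣m*n t ∣-refl)

    7∣-mod-7⇐ : + 7 ∣ s′ → + 7 ∣ s
    7∣-mod-7⇐ 7∣s′ = subst (+ 7 ∣_) (sym eq) (∣m∣n⇒∣m+n 7∣s′ (∣m⇒∣m*n t ∣-refl))

  -- Representatives of the left classes, modulo units, of Lipschitz quaternions of norm 7.
  norm7 : List (ℤ × ℤ × ℤ × ℤ)
  norm7 = cartesianProduct (+ 2 ∷ []) (cartesianProduct ±1 (cartesianProduct ±1 ±1))
    where ±1 = ℤ.1ℤ ∷ ℤ.-1ℤ ∷ []

  norm7-dot⁴ : ∀ {α} → α ∈ norm7 → dot⁴ α α ≡ + 7
  norm7-dot⁴ = All.lookup (from-yes (All.all? (λ α → dot⁴ α α ℤ.≟ + 7) norm7))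

  -- Decides whether v = α w for an integral w: as ᾱα = 7, this amounts to 7 ∣ ᾱv, which can be read
  -- off from v modulo 7.
  left-divisible? : ∀ α v → Dec (+ 7 ∣⁴ left (conj α) v)
  left-divisible? α v = + 7 ∣⁴? left (conj α) v

  left-count : ℤ × ℤ × ℤ × ℤ → ℕ
  left-count v = length (filter (λ α → left-divisible? α v) norm7)

  left-count-mod-7 : ∀ x y → left-count (x +⁴ scale⁴ (+ 7) y) ≡ left-count x
  left-count-mod-7 x y = cong length (filter-≐
    (λ α → left-divisible? α (x +⁴ scale⁴ (+ 7) y)) (λ α → left-divisible? α x)
    ( (λ {α} (p , q , r , s) → let β = conj α in
        7∣-mod-7⇒ (dot⁴-mod-7 (left₁ β) x y) p , 7∣-mod-7⇒ (dot⁴-mod-7 (left₂ β) x y) q ,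
        7∣-mod-7⇒ (dot⁴-mod-7 (left₃ β) x y) r , 7∣-mod-7⇒ (dot⁴-mod-7 (left₄ β) x y) s)
    , (λ {α} (p , q , r , s) → let β = conj α in
        7∣-mod-7⇐ (dot⁴-mod-7 (left₁ β) x y) p , 7∣-mod-7⇐ (dot⁴-mod-7 (left₂ β) x y) q ,
        7∣-mod-7⇐ (dot⁴-mod-7 (left₃ β) x y) r , 7∣-mod-7⇐ (dot⁴-mod-7 (left₄ β) x y) s)) norm7)

  -- Evaluated on all 7⁴ residues. In the matrix picture ᾱx = 0 says that the image of x lies in the
  -- image of α. A singular x ≠ 0 has a line as image, which belongs to one α; for x = 0 all eight
  -- qualify, and 8 ≡ 1.
  left-count-residues : ∀ (h i j k : Fin 7) → let x = + toℕ h , [ i , j , k ] in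
                        + 7 ∣ dot⁴ x x → left-count x ≡₇ 1
  left-count-residues = from-yes (Fin.all? {n = 7} λ h → Fin.all? λ i → Fin.all? λ j → Fin.all? λ k →
    let x = + toℕ h , [ i , j , k ] in + 7 ∣? dot⁴ x x →-dec (left-count x % 7 ℕ.≟ 1))

  left-count≡1 : ∀ {v} → + 7 ∣ dot⁴ v v → left-count v ≡₇ 1
  left-count≡1 {w , v} 7∣v with h , p , refl ← residue w | i , j , k , q , refl ← residue³ v =
    trans (cong (_% 7) (left-count-mod-7 x (p , q)))
      (left-count-residues h i j k (7∣-mod-7⇒ (proj₂ (dot⁴-square-mod-7 x (p , q))) 7∣v))
    where x = + toℕ h , [ i , j , k ]

  sphere⁴-7n : ∀ {N} n → 7 ℕ.* n ≤ N → length (sphere⁴ N (7 ℕ.* n)) ≡₇ length (sphere⁴ N n)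
  sphere⁴-7n {N} n 7n≤N = begin
    length (S (7 ℕ.* n)) % 7
      ≡⟨ cong (_% 7) (∑-1 (S (7 ℕ.* n))) ⟨
    ∑ (S (7 ℕ.* n)) (λ _ → 1) % 7
      ≡⟨ ∑-cong-∈ (S (7 ℕ.* n)) (λ {v} v∈S → left-count≡1 {v} (7∣dot v∈S)) ⟨
    ∑ (S (7 ℕ.* n)) left-count % 7
      ≡⟨ cong (_% 7) (sphere-double-count 7 n norm7 left-divisible? image) ⟨
    8 ℕ.* length (S n) % 7
      ≡⟨ 8m≡m (length (S n)) ⟩
    length (S n) % 7 ∎
    where
    open ≡-Reasoning
    open Similitudes ∥_∥⁴ (box⁴ N) (box⁴-unique N) (∈-box⁴ {N})
    S = sphere⁴ N

    7∣dot : ∀ {v} → v ∈ S (7 ℕ.* n) → + 7 ∣ dot⁴ v v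
    7∣dot {v} v∈S = divides (+ n) (trans (sym (+∥∥⁴ v))
      (trans (cong +_ (trans (∈-sphere v∈S) (ℕ.*-comm 7 n))) (ℤ.pos-* n 7)))

    image : ∀ {α} → α ∈ norm7 → length (filter (left-divisible? α) (S (7 ℕ.* n))) ≡ length (S n)
    image {α} α∈ = sphere-image 7 n 7n≤N (left α) injective norm (left-divisible? α)
      (λ w → subst (+ 7 ∣⁴_) (sym (back w)) (∣-scale⁴ w))
      -- From ᾱv = 7w = ᾱ(αw), injectivity of multiplication by ᾱ gives αw = v.
      (λ {v} 7∣ → let w , eq = ∣⁴⇒scale 7∣ in
        w , left-conj-injective (trans (back w) eq))
      where
      back : ∀ w → left (conj α) (left α w) ≡ scale⁴ (+ 7) w
      back w = trans (left-conj-left α w) (cong (λ m → scale⁴ m w) (norm7-dot⁴ α∈))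

      forth : ∀ v → left α (left (conj α) v) ≡ scale⁴ (+ 7) v
      forth v = trans (cong (λ β → left β (left (conj α) v)) (sym (conj-involutive α)))
        (trans (left-conj-left (conj α) v) (cong (λ m → scale⁴ m v) (trans (dot⁴-conj α) (norm7-dot⁴ α∈))))

      injective : ∀ {v w} → left α v ≡ left α w → v ≡ w
      injective {v} {w} eq = scale⁴-injective {+ 7} (trans (sym (back v)) (trans (cong (left (conj α)) eq) (back w)))

      left-conj-injective : ∀ {v w} → left (conj α) v ≡ left (conj α) w → v ≡ w
      left-conj-injective {v} {w} eq = scale⁴-injective {+ 7} (trans (sym (forth v)) (trans (cong (left α) eq) (forth w)))

      norm : ∀ w → ∥ left α w ∥⁴ ≡ 7 ℕ.* ∥ w ∥⁴
      norm w = ℤ.+-injective (begin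
        + ∥ left α w ∥⁴ ≡⟨ +∥∥⁴ (left α w) ⟩
        dot⁴ (left α w) (left α w) ≡⟨ dot⁴-left α w ⟩
        dot⁴ α α ℤ.* dot⁴ w w ≡⟨ cong₂ ℤ._*_ (norm7-dot⁴ α∈) (sym (+∥∥⁴ w)) ⟩
        + 7 ℤ.* + ∥ w ∥⁴ ≡⟨ ℤ.pos-* 7 ∥ w ∥⁴ ⟨
        + (7 ℕ.* ∥ w ∥⁴) ∎)

  -- With m = 49 this decides whether v = α w ᾱ for an integral w; m = 7 is its shadow, visible from
  -- v modulo 7.
  rotate-divisible? : ∀ m α v → Dec (m ∣³ rotate (conj α) v)
  rotate-divisible? m α v = m ∣³? rotate (conj α) v

  rotate-count : ℤ → ℤ × ℤ × ℤ → ℕ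
  rotate-count m v = length (filter (λ α → rotate-divisible? m α v) norm7)

  rotate-divisible-mod-7⇒ : ∀ α x y → + 7 ∣³ rotate α (x +³ scale³ (+ 7) y) → + 7 ∣³ rotate α x
  rotate-divisible-mod-7⇒ α x y (p , q , r) =
    7∣-mod-7⇒ (dot³-mod-7 (rotate₁ α) x y) p ,
    7∣-mod-7⇒ (dot³-mod-7 (rotate₂ α) x y) q ,
    7∣-mod-7⇒ (dot³-mod-7 (rotate₃ α) x y) r

  rotate-divisible-mod-7⇐ : ∀ α x y → + 7 ∣³ rotate α x → + 7 ∣³ rotate α (x +³ scale³ (+ 7) y)
  rotate-divisible-mod-7⇐ α x y (p , q , r) =
    7∣-mod-7⇐ (dot³-mod-7 (rotate₁ α) x y) p ,
    7∣-mod-7⇐ (dot³-mod-7 (rotate₂ α) x y) q ,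
    7∣-mod-7⇐ (dot³-mod-7 (rotate₃ α) x y) r

  rotate-count-mod-7 : ∀ x y → rotate-count (+ 7) (x +³ scale³ (+ 7) y) ≡ rotate-count (+ 7) x
  rotate-count-mod-7 x y = cong length (filter-≐
    (λ α → rotate-divisible? (+ 7) α (x +³ scale³ (+ 7) y)) (λ α → rotate-divisible? (+ 7) α x)
    ((λ {α} → rotate-divisible-mod-7⇒ (conj α) x y) , (λ {α} → rotate-divisible-mod-7⇐ (conj α) x y))
    norm7)

  -- The n modulo 7 for which -n is a nonzero square.
  residues : List ℕ
  residues = 3 ∷ 5 ∷ 6 ∷ []

  -- Evaluated on all 7³ residues. In the matrix picture ᾱxα = 0 says that x maps the image of α
  -- into the kernel of ᾱ, which is that same line, so the eigenlines of x are counted. As x has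
  -- trace 0 and x² = -(x·x), there are two if -(x·x) is a nonzero square, one if x is nilpotent and
  -- nonzero, and eight if x = 0.
  rotate-count-residues : ∀ (i j k : Fin 7) → let x = [ i , j , k ] in
    (+ 7 ∣ dot³ x x → rotate-count (+ 7) x ≡₇ 1) ×
    All (λ c → + 7 ∣ dot³ x x ℤ.+ ℤ.- (+ c) → rotate-count (+ 7) x ≡₇ 2) residues
  rotate-count-residues = from-yes (Fin.all? {n = 7} λ i → Fin.all? λ j → Fin.all? λ k →
    let x = [ i , j , k ] in
    (+ 7 ∣? dot³ x x →-dec (rotate-count (+ 7) x % 7 ℕ.≟ 1)) ×-dec
    All.all? (λ c → + 7 ∣? dot³ x x ℤ.+ ℤ.- (+ c) →-dec (rotate-count (+ 7) x % 7 ℕ.≟ 2)) residues)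

  rotate-count≡1 : ∀ {v} → + 7 ∣ dot³ v v → rotate-count (+ 7) v ≡₇ 1
  rotate-count≡1 {v} 7∣v with i , j , k , q , refl ← residue³ v =
    trans (cong (_% 7) (rotate-count-mod-7 [ i , j , k ] q))
      (proj₁ (rotate-count-residues i j k) (7∣-mod-7⇒ (proj₂ (dot³-square-mod-7 [ i , j , k ] q)) 7∣v))

  rotate-count≡2 : ∀ {v c} → c ∈ residues → + 7 ∣ dot³ v v ℤ.+ ℤ.- (+ c) → rotate-count (+ 7) v ≡₇ 2
  rotate-count≡2 {v} {c} c∈ 7∣v-c with i , j , k , q , refl ← residue³ v =
    trans (cong (_% 7) (rotate-count-mod-7 x q))
      (All.lookup (proj₂ (rotate-count-residues i j k)) c∈ (7∣-mod-7⇒ {s′ = dot³ x x ℤ.+ ℤ.- (+ c)} {t = t} eq 7∣v-c))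
    where
    x = [ i , j , k ]
    t = proj₁ (dot³-square-mod-7 x q)
    eq = trans (cong (ℤ._+ ℤ.- (+ c)) (proj₂ (dot³-square-mod-7 x q)))
      (solve 3 (λ d t c → d :+ con (+ 7) :* t :+ :- c := d :+ :- c :+ con (+ 7) :* t) refl (dot³ x x) t (+ c))

  rotate-scale³ : ∀ α m v → rotate α (scale³ m v) ≡ scale³ m (rotate α v)
  rotate-scale³ α m v = ,-cong³ (dot³-scale³ (rotate₁ α) v) (dot³-scale³ (rotate₂ α) v) (dot³-scale³ (rotate₃ α) v)
    where
    dot³-scale³ : ∀ r v → dot³ r (scale³ m v) ≡ m ℤ.* dot³ r v
    dot³-scale³ (r₁ , r₂ , r₃) (x , y , z) = solve 7 (λ m r₁ r₂ r₃ x y z →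
      let r = r₁ , r₂ , r₃ ; v = x , y , z in P.dot³ r (P.scale³ m v) := m :* P.dot³ r v) refl m r₁ r₂ r₃ x y z

  -- For vectors divisible by 7 one factor cancels, which makes the condition modulo 49 a condition
  -- on residues modulo 7.
  rotate-count-scale : ∀ v → rotate-count (+ 49) (scale³ (+ 7) v) ≡ rotate-count (+ 7) v
  rotate-count-scale v = cong length (filter-≐
    (λ α → rotate-divisible? (+ 49) α (scale³ (+ 7) v)) (λ α → rotate-divisible? (+ 7) α v)
    ( (λ {α} 49∣ → cancel (subst (+ 49 ∣³_) (rotate-scale³ (conj α) (+ 7) v) 49∣))
    , (λ {α} 7∣ → subst (+ 49 ∣³_) (sym (rotate-scale³ (conj α) (+ 7) v)) (mono 7∣)))
    norm7)
    where
    cancel : ∀ {v} → + 49 ∣³ scale³ (+ 7) v → + 7 ∣³ v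
    cancel (p , q , r) = *-cancelˡ-∣ (+ 7) p , *-cancelˡ-∣ (+ 7) q , *-cancelˡ-∣ (+ 7) r
    mono : ∀ {v} → + 7 ∣³ v → + 49 ∣³ scale³ (+ 7) v
    mono (p , q , r) = *-monoʳ-∣ (+ 7) p , *-monoʳ-∣ (+ 7) q , *-monoʳ-∣ (+ 7) r

  -- r is congruent modulo 7 to a unit multiple κ x of x, where μ is the inverse of 2 κ.
  Proportional : ℤ × ℤ × ℤ → ℤ × ℤ × ℤ → Set
  Proportional r x = ∃₂ λ (κ μ : Fin 7) →
    + 7 ∣ + 2 ℤ.* + toℕ κ ℤ.* + toℕ μ ℤ.+ ℤ.-1ℤ × + 7 ∣³ r +³ scale³ (ℤ.- (+ toℕ κ)) x

  proportional? : ∀ r x → Dec (Proportional r x)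
  proportional? r x = Fin.any? {n = 7} λ κ → Fin.any? {n = 7} λ μ →
    + 7 ∣? + 2 ℤ.* + toℕ κ ℤ.* + toℕ μ ℤ.+ ℤ.-1ℤ ×-dec + 7 ∣³? r +³ scale³ (ℤ.- (+ toℕ κ)) x

  -- Each row r of the rotation is nonzero modulo 7 and isotropic, as r·r = 49; the hypotheses make
  -- x isotropic and orthogonal to r. A nondegenerate form in three variables has no totally
  -- isotropic plane, so r and x span the same line. Confirmed by evaluation.
  rotate-proportional-residues : ∀ (i j k : Fin 7) → let x = [ i , j , k ] in
    ¬ + 7 ∣³ x → + 7 ∣ dot³ x x →
    All (λ α → let β = conj α in + 7 ∣³ rotate β x →
      Proportional (rotate₁ β) x × Proportional (rotate₂ β) x × Proportional (rotate₃ β) x) norm7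
  rotate-proportional-residues = from-yes (Fin.all? {n = 7} λ i → Fin.all? λ j → Fin.all? λ k →
    let x = [ i , j , k ] in
    ¬? (+ 7 ∣³? x) →-dec + 7 ∣? dot³ x x →-dec
    All.all? (λ α → let β = conj α in + 7 ∣³? rotate β x →-dec
      (proportional? (rotate₁ β) x ×-dec proportional? (rotate₂ β) x ×-dec proportional? (rotate₃ β) x)) norm7)

  -- From r = κ v + 7 d one gets r·r = κ² v·v + 14 κ v·d + 49 d·d, so 7 divides v·d, and r·v = κ v·v + 7 v·d.
  proportional⇒49∣dot³ : ∀ {r x} y → let v = x +³ scale³ (+ 7) y in
    Proportional r x → dot³ r r ≡ + 49 → + 49 ∣ dot³ v v → + 49 ∣ dot³ r v
  proportional⇒49∣dot³ {r₁ , r₂ , r₃} {x₁ , x₂ , x₃} (y₁ , y₂ , y₃)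
    (k , m , divides ν 2κμ-1≡7ν , divides q₁ eq₁ , divides q₂ eq₂ , divides q₃ eq₃) r·r≡49 (divides n v·v≡49n) =
    divides (κ ℤ.* n ℤ.+ (μ ℤ.* s ℤ.+ ℤ.- (ν ℤ.* e))) (begin
      dot³ r v
        ≡⟨ cong (λ r → dot³ r v) r≡ ⟩
      dot³ (scale³ κ v +³ scale³ (+ 7) d) v
        ≡⟨ solve 7 (λ κ v₁ v₂ v₃ d₁ d₂ d₃ → let v = v₁ , v₂ , v₃ ; d = d₁ , d₂ , d₃ in
             P.dot³ (P.scale³ κ v P.+³ P.scale³ (con (+ 7)) d) v := κ :* P.dot³ v v :+ con (+ 7) :* P.dot³ v d)
             refl κ v₁ v₂ v₃ d₁ d₂ d₃ ⟩
      κ ℤ.* dot³ v v ℤ.+ + 7 ℤ.* e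
        ≡⟨ cong₂ (λ a b → κ ℤ.* a ℤ.+ + 7 ℤ.* b) v·v≡49n e≡ ⟩
      κ ℤ.* (n ℤ.* + 49) ℤ.+ + 7 ℤ.* (+ 7 ℤ.* (μ ℤ.* s ℤ.+ ℤ.- (ν ℤ.* e)))
        ≡⟨ solve 3 (λ κ n t → κ :* (n :* con (+ 49)) :+ con (+ 7) :* (con (+ 7) :* t) :=
             (κ :* n :+ t) :* con (+ 49)) refl κ n _ ⟩
      (κ ℤ.* n ℤ.+ (μ ℤ.* s ℤ.+ ℤ.- (ν ℤ.* e))) ℤ.* + 49 ∎)
    where
    open ≡-Reasoning
    κ = + toℕ k
    μ = + toℕ m
    r = r₁ , r₂ , r₃
    v₁ = x₁ ℤ.+ + 7 ℤ.* y₁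
    v₂ = x₂ ℤ.+ + 7 ℤ.* y₂
    v₃ = x₃ ℤ.+ + 7 ℤ.* y₃
    v = v₁ , v₂ , v₃
    -- From r = κ x + 7 q and v = x + 7 y one gets r = κ v + 7 (q - κ y).
    d₁ = q₁ ℤ.+ ℤ.- (κ ℤ.* y₁)
    d₂ = q₂ ℤ.+ ℤ.- (κ ℤ.* y₂)
    d₃ = q₃ ℤ.+ ℤ.- (κ ℤ.* y₃)
    d = d₁ , d₂ , d₃
    e = dot³ v d
    s = ℤ.1ℤ ℤ.+ ℤ.- (κ ℤ.* κ ℤ.* n ℤ.+ dot³ d d)

    component : ∀ r x y q → r ℤ.+ ℤ.- κ ℤ.* x ≡ q ℤ.* + 7 →
                r ≡ κ ℤ.* (x ℤ.+ + 7 ℤ.* y) ℤ.+ + 7 ℤ.* (q ℤ.+ ℤ.- (κ ℤ.* y))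
    component r x y q eq = begin
      r
        ≡⟨ solve 3 (λ r κ x → r := r :+ :- κ :* x :+ κ :* x) refl r κ x ⟩
      r ℤ.+ ℤ.- κ ℤ.* x ℤ.+ κ ℤ.* x
        ≡⟨ cong (ℤ._+ κ ℤ.* x) eq ⟩
      q ℤ.* + 7 ℤ.+ κ ℤ.* x
        ≡⟨ solve 4 (λ κ x y q → q :* con (+ 7) :+ κ :* x :=
             κ :* (x :+ con (+ 7) :* y) :+ con (+ 7) :* (q :+ :- (κ :* y))) refl κ x y q ⟩
      κ ℤ.* (x ℤ.+ + 7 ℤ.* y) ℤ.+ + 7 ℤ.* (q ℤ.+ ℤ.- (κ ℤ.* y)) ∎

    r≡ : r ≡ scale³ κ v +³ scale³ (+ 7) d
    r≡ = ,-cong³ (component r₁ x₁ y₁ q₁ eq₁) (component r₂ x₂ y₂ q₂ eq₂) (component r₃ x₃ y₃ q₃ eq₃)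

    2κe≡7s : + 2 ℤ.* κ ℤ.* e ≡ + 7 ℤ.* s
    2κe≡7s = ℤ.*-cancelˡ-≡ (+ 7) _ _ (begin
      + 7 ℤ.* (+ 2 ℤ.* κ ℤ.* e)
        ≡⟨ solve 7 (λ κ v₁ v₂ v₃ d₁ d₂ d₃ →
             let v = v₁ , v₂ , v₃ ; d = d₁ , d₂ , d₃ ; r = P.scale³ κ v P.+³ P.scale³ (con (+ 7)) d in
             con (+ 7) :* (con (+ 2) :* κ :* P.dot³ v d) :=
             P.dot³ r r :+ :- (κ :* κ :* P.dot³ v v :+ con (+ 49) :* P.dot³ d d)) refl κ v₁ v₂ v₃ d₁ d₂ d₃ ⟩
      dot³ r′ r′ ℤ.+ ℤ.- (κ ℤ.* κ ℤ.* dot³ v v ℤ.+ + 49 ℤ.* dot³ d d)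
        ≡⟨ cong₂ (λ a b → a ℤ.+ ℤ.- (κ ℤ.* κ ℤ.* b ℤ.+ + 49 ℤ.* dot³ d d))
             (trans (cong (λ r → dot³ r r) (sym r≡)) r·r≡49) v·v≡49n ⟩
      + 49 ℤ.+ ℤ.- (κ ℤ.* κ ℤ.* (n ℤ.* + 49) ℤ.+ + 49 ℤ.* dot³ d d)
        ≡⟨ solve 3 (λ κ n f → con (+ 49) :+ :- (κ :* κ :* (n :* con (+ 49)) :+ con (+ 49) :* f) :=
             con (+ 7) :* (con (+ 7) :* (con (+ 1) :+ :- (κ :* κ :* n :+ f)))) refl κ n (dot³ d d) ⟩
      + 7 ℤ.* (+ 7 ℤ.* s) ∎)
      where r′ = scale³ κ v +³ scale³ (+ 7) d

    e≡ : e ≡ + 7 ℤ.* (μ ℤ.* s ℤ.+ ℤ.- (ν ℤ.* e))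
    -- Division by 2κ modulo 7: in e = μ (2κ e) - (2κμ - 1) e both terms are visibly multiples of 7.
    e≡ = begin
      e
        ≡⟨ solve 3 (λ κ μ e → e := μ :* (con (+ 2) :* κ :* e) :+ :- ((con (+ 2) :* κ :* μ :+ con ℤ.-1ℤ) :* e)) refl κ μ e ⟩
      μ ℤ.* (+ 2 ℤ.* κ ℤ.* e) ℤ.+ ℤ.- ((+ 2 ℤ.* κ ℤ.* μ ℤ.+ ℤ.-1ℤ) ℤ.* e)
        ≡⟨ cong₂ (λ a b → μ ℤ.* a ℤ.+ ℤ.- (b ℤ.* e)) 2κe≡7s 2κμ-1≡7ν ⟩
      μ ℤ.* (+ 7 ℤ.* s) ℤ.+ ℤ.- (ν ℤ.* + 7 ℤ.* e)
        ≡⟨ solve 4 (λ μ s ν e → μ :* (con (+ 7) :* s) :+ :- (ν :* con (+ 7) :* e) :=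
             con (+ 7) :* (μ :* s :+ :- (ν :* e))) refl μ s ν e ⟩
      + 7 ℤ.* (μ ℤ.* s ℤ.+ ℤ.- (ν ℤ.* e)) ∎

  norm7-rotate : ∀ {α} → α ∈ norm7 → let β = conj α in
    dot³ (rotate₁ β) (rotate₁ β) ≡ + 49 × dot³ (rotate₂ β) (rotate₂ β) ≡ + 49 × dot³ (rotate₃ β) (rotate₃ β) ≡ + 49
  norm7-rotate = All.lookup (from-yes (All.all? (λ α → let β = conj α in
    (dot³ (rotate₁ β) (rotate₁ β) ℤ.≟ + 49) ×-dec (dot³ (rotate₂ β) (rotate₂ β) ℤ.≟ + 49) ×-dec
    (dot³ (rotate₃ β) (rotate₃ β) ℤ.≟ + 49)) norm7))

  -- The lift from 7 to 49, which no evaluation on residues modulo 7 can give. Every row of the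
  -- rotation is proportional to v modulo 7, and since the row and v both have norm divisible by 49,
  -- so is their product.
  rotate-divisible-7⇒49 : ∀ {v α} → α ∈ norm7 → ¬ + 7 ∣³ v → + 49 ∣ dot³ v v →
                          + 7 ∣³ rotate (conj α) v → + 49 ∣³ rotate (conj α) v
  rotate-divisible-7⇒49 {v} {α} α∈ 7∤v 49∣v·v 7∣ with i , j , k , q , refl ← residue³ v =
    conclude (rotate₁ β) (proj₁ proportional) (proj₁ (norm7-rotate α∈)) ,
    conclude (rotate₂ β) (proj₁ (proj₂ proportional)) (proj₁ (proj₂ (norm7-rotate α∈))) ,
    conclude (rotate₃ β) (proj₂ (proj₂ proportional)) (proj₂ (proj₂ (norm7-rotate α∈)))
    where
    β = conj α
    x = [ i , j , k ]

    conclude : ∀ r → Proportional r x → dot³ r r ≡ + 49 → + 49 ∣ dot³ r (x +³ scale³ (+ 7) q)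
    conclude r ∝ r·r≡49 = proportional⇒49∣dot³ {r} {x} q ∝ r·r≡49 49∣v·v

    7∤x : ¬ + 7 ∣³ x
    7∤x (p₁ , p₂ , p₃) = 7∤v (lift (proj₁ q) p₁ , lift (proj₁ (proj₂ q)) p₂ , lift (proj₂ (proj₂ q)) p₃)
      where
      lift : ∀ {a} b → + 7 ∣ a → + 7 ∣ a ℤ.+ + 7 ℤ.* b
      lift b 7∣a = ∣m∣n⇒∣m+n 7∣a (∣m⇒∣m*n b ∣-refl)

    proportional = All.lookup
      (rotate-proportional-residues i j k 7∤x
        (7∣-mod-7⇒ (proj₂ (dot³-square-mod-7 x q)) (∣-trans (divides (+ 7) refl) 49∣v·v)))
      α∈ (rotate-divisible-mod-7⇒ (conj α) x q 7∣)

  -- The equivalence of divisibility by 7 and by 49 is established for the α of `norm7`, so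
  -- membership in the list has to be available when the predicates are compared.
  length-filter-cong-∈ : ∀ {A : Set} {P Q : A → Set} (P? : Decidable P) (Q? : Decidable Q) as →
    (∀ {a} → a ∈ as → P a → Q a) → (∀ {a} → a ∈ as → Q a → P a) →
    length (filter P? as) ≡ length (filter Q? as)
  length-filter-cong-∈ P? Q? [] P⇒Q Q⇒P = refl
  length-filter-cong-∈ P? Q? (a ∷ as) P⇒Q Q⇒P with P? a | Q? a | length-filter-cong-∈ P? Q? as (P⇒Q ∘ there) (Q⇒P ∘ there)
  ... | yes _ | yes _ | eq = cong suc eq
  ... | no _ | no _ | eq = eq
  ... | yes p | no ¬q | _ = contradiction (P⇒Q (here refl) p) ¬q
  ... | no ¬p | yes q | _ = contradiction (Q⇒P (here refl) q) ¬p

  module _ {N} n (49n≤N : 49 ℕ.* n ≤ N) where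

    private
      open Similitudes ∥_∥³ (box³ N) (box³-unique N) (∈-box³ {N})
      S = sphere³ N

      dot³-sphere : ∀ {m v} → v ∈ S m → dot³ v v ≡ + m
      dot³-sphere {v = v} v∈S = trans (sym (+∥∥³ v)) (cong +_ (∈-sphere v∈S))

      rotate-image : ∀ {α} → α ∈ norm7 → length (filter (rotate-divisible? (+ 49) α) (S (49 ℕ.* n))) ≡ length (S n)
      rotate-image {α} α∈ = sphere-image 49 n 49n≤N (rotate α) injective norm (rotate-divisible? (+ 49) α)
        (λ w → subst (+ 49 ∣³_) (sym (back w)) (∣-scale³ w))
        (λ {v} 49∣ → let w , eq = ∣³⇒scale 49∣ in
          w , rotate-conj-injective (trans (back w) eq))
        where
        back : ∀ w → rotate (conj α) (rotate α w) ≡ scale³ (+ 49) w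
        back w = trans (rotate-conj-rotate α w) (cong (λ m → scale³ (m ℤ.* m) w) (norm7-dot⁴ α∈))

        forth : ∀ v → rotate α (rotate (conj α) v) ≡ scale³ (+ 49) v
        forth v = trans (cong (λ β → rotate β (rotate (conj α) v)) (sym (conj-involutive α)))
          (trans (rotate-conj-rotate (conj α) v)
            (cong (λ m → scale³ (m ℤ.* m) v) (trans (dot⁴-conj α) (norm7-dot⁴ α∈))))

        injective : ∀ {v w} → rotate α v ≡ rotate α w → v ≡ w
        injective {v} {w} eq = scale³-injective {+ 49} (trans (sym (back v)) (trans (cong (rotate (conj α)) eq) (back w)))

        rotate-conj-injective : ∀ {v w} → rotate (conj α) v ≡ rotate (conj α) w → v ≡ w
        rotate-conj-injective {v} {w} eq =
          scale³-injective {+ 49} (trans (sym (forth v)) (trans (cong (rotate α) eq) (forth w)))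

        norm : ∀ w → ∥ rotate α w ∥³ ≡ 49 ℕ.* ∥ w ∥³
        norm w = ℤ.+-injective (begin
          + ∥ rotate α w ∥³ ≡⟨ +∥∥³ (rotate α w) ⟩
          dot³ (rotate α w) (rotate α w) ≡⟨ dot³-rotate α w ⟩
          dot⁴ α α ℤ.* dot⁴ α α ℤ.* dot³ w w
            ≡⟨ cong₂ (λ m d → m ℤ.* m ℤ.* d) (norm7-dot⁴ α∈) (sym (+∥∥³ w)) ⟩
          + 49 ℤ.* + ∥ w ∥³ ≡⟨ ℤ.pos-* 49 ∥ w ∥³ ⟨
          + (49 ℕ.* ∥ w ∥³) ∎)
          where open ≡-Reasoning

      ∥scale∥ : ∀ u → ∥ scale³ (+ 7) u ∥³ ≡ 49 ℕ.* ∥ u ∥³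
      ∥scale∥ u@(x , y , z) = ℤ.+-injective (begin
        + ∥ scale³ (+ 7) u ∥³ ≡⟨ +∥∥³ (scale³ (+ 7) u) ⟩
        dot³ (scale³ (+ 7) u) (scale³ (+ 7) u)
          ≡⟨ solve 3 (λ x y z → let v = P.scale³ (con (+ 7)) (x , y , z) in
               P.dot³ v v := con (+ 49) :* P.dot³ (x , y , z) (x , y , z)) refl x y z ⟩
        + 49 ℤ.* dot³ u u ≡⟨ cong (+ 49 ℤ.*_) (+∥∥³ u) ⟨
        + 49 ℤ.* + ∥ u ∥³ ≡⟨ ℤ.pos-* 49 ∥ u ∥³ ⟨
        + (49 ℕ.* ∥ u ∥³) ∎)
        where open ≡-Reasoning

      -- Multiplication by 7 is itself a similitude of ratio 49, so r₃(n) counts the vectors of norm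
      -- 49n that are divisible by 7.
      scale-image : length (filter (+ 7 ∣³?_) (S (49 ℕ.* n))) ≡ length (S n)
      scale-image = sphere-image 49 n 49n≤N (scale³ (+ 7)) (scale³-injective {+ 7}) ∥scale∥
        (+ 7 ∣³?_) ∣-scale³ ∣³⇒scale

    module _ k (count≡1+k : ∀ {v} → dot³ v v ≡ + n → rotate-count (+ 7) v ≡₇ 1 ℕ.+ k) where

      private
        rotate-count-49 : ∀ {v} → v ∈ S (49 ℕ.* n) →
                          rotate-count (+ 49) v ≡₇ 1 ℕ.+ k ℕ.* indicator (+ 7 ∣³?_) v
        rotate-count-49 {v} v∈S with + 7 ∣³? v
        ... | yes 7∣v with u , refl ← ∣³⇒scale 7∣v = begin
          rotate-count (+ 49) (scale³ (+ 7) u) % 7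
            ≡⟨ cong (_% 7) (rotate-count-scale u) ⟩
          rotate-count (+ 7) u % 7
            ≡⟨ count≡1+k {u} (trans (sym (+∥∥³ u)) (cong +_
                 (ℕ.*-cancelˡ-≡ ∥ u ∥³ n 49 (trans (sym (∥scale∥ u)) (∈-sphere v∈S))))) ⟩
          (1 ℕ.+ k) % 7
            ≡⟨ cong (λ m → (1 ℕ.+ m) % 7) (trans (cong (k ℕ.*_) (indicator-yes (+ 7 ∣³?_) 7∣v)) (ℕ.*-identityʳ k)) ⟨
          (1 ℕ.+ k ℕ.* indicator (+ 7 ∣³?_) (scale³ (+ 7) u)) % 7 ∎
          where open ≡-Reasoning
        ... | no 7∤v = begin
          rotate-count (+ 49) v % 7
            ≡⟨ cong (_% 7) (length-filter-cong-∈
                   (λ α → rotate-divisible? (+ 49) α v) (λ α → rotate-divisible? (+ 7) α v) norm7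
                 (λ _ (p , q , r) → let 7∣49 = divides (+ 7) refl in ∣-trans 7∣49 p , ∣-trans 7∣49 q , ∣-trans 7∣49 r)
                 (λ {α} α∈ → rotate-divisible-7⇒49 {v} {α} α∈ 7∤v 49∣v·v)) ⟩
          rotate-count (+ 7) v % 7
            ≡⟨ rotate-count≡1 {v} (∣-trans (divides (+ 7) refl) 49∣v·v) ⟩
          1
            ≡⟨ cong (λ m → (1 ℕ.+ m) % 7) (trans (cong (k ℕ.*_) (indicator-no (+ 7 ∣³?_) 7∤v)) (ℕ.*-zeroʳ k)) ⟨
          (1 ℕ.+ k ℕ.* indicator (+ 7 ∣³?_) v) % 7 ∎
          where
          open ≡-Reasoning
          49∣v·v : + 49 ∣ dot³ v v
          49∣v·v = divides (+ n) (trans (dot³-sphere v∈S) (trans (cong +_ (ℕ.*-comm 49 n)) (ℤ.pos-* n 49)))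

      -- T(49) acting on θ³ modulo 7, with k in the role of the Legendre symbol (-n / 7).
      sphere³-hecke : length (S (49 ℕ.* n)) ℕ.+ k ℕ.* length (S n) ≡₇ length (S n)
      sphere³-hecke = begin
        (length S₄₉ ℕ.+ k ℕ.* length (S n)) % 7
          ≡⟨ cong (λ l → (length S₄₉ ℕ.+ k ℕ.* l) % 7) (trans (sym scale-image) (length-filter≡∑ (+ 7 ∣³?_) S₄₉)) ⟩
        (length S₄₉ ℕ.+ k ℕ.* ∑ S₄₉ (indicator (+ 7 ∣³?_))) % 7
          ≡⟨ cong₂ (λ a b → (a ℕ.+ b) % 7) (∑-1 S₄₉) (∑-*ˡ S₄₉ k (indicator (+ 7 ∣³?_))) ⟨
        (∑ S₄₉ (λ _ → 1) ℕ.+ ∑ S₄₉ (λ v → k ℕ.* indicator (+ 7 ∣³?_) v)) % 7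
          ≡⟨ cong (_% 7) (∑-+ S₄₉ (λ _ → 1) (λ v → k ℕ.* indicator (+ 7 ∣³?_) v)) ⟨
        ∑ S₄₉ (λ v → 1 ℕ.+ k ℕ.* indicator (+ 7 ∣³?_) v) % 7
          ≡⟨ ∑-cong-∈ S₄₉ rotate-count-49 ⟨
        ∑ S₄₉ (rotate-count (+ 49)) % 7
          ≡⟨ cong (_% 7) (sphere-double-count 49 n norm7 (rotate-divisible? (+ 49)) rotate-image) ⟨
        8 ℕ.* length (S n) % 7
          ≡⟨ 8m≡m (length (S n)) ⟩
        length (S n) % 7 ∎
        where
        open ≡-Reasoning
        S₄₉ = S (49 ℕ.* n)

  -- The case k = 0: vectors of norm 7n are isotropic modulo 7.
  sphere³-49·7n : ∀ {N} n → 49 ℕ.* (7 ℕ.* n) ≤ N →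
                  length (sphere³ N (49 ℕ.* (7 ℕ.* n))) ≡₇ length (sphere³ N (7 ℕ.* n))
  sphere³-49·7n {N} n ≤N = trans (cong (_% 7) (sym (ℕ.+-identityʳ (length (sphere³ N (49 ℕ.* (7 ℕ.* n)))))))
    (sphere³-hecke (7 ℕ.* n) ≤N 0 λ {v} v·v≡7n → rotate-count≡1 {v}
      (divides (+ n) (trans v·v≡7n (trans (cong +_ (ℕ.*-comm 7 n)) (ℤ.pos-* n 7)))))

  -- The case k = 1: with t = 7n + c the relation reads r₃(49t) + r₃(t) ≡ r₃(t).
  sphere³-49[7n+c] : ∀ {N} n {c} → c ∈ residues → 49 ℕ.* (7 ℕ.* n ℕ.+ c) ≤ N →
                     length (sphere³ N (49 ℕ.* (7 ℕ.* n ℕ.+ c))) ≡₇ 0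
  sphere³-49[7n+c] {N} n {c} c∈ ≤N = m+1n≡₇n⇒m≡₇0 (length (sphere³ N (49 ℕ.* t))) (length (sphere³ N t))
    (sphere³-hecke t ≤N 1 λ {v} v·v≡t → rotate-count≡2 {v} c∈
      (divides (+ n) (begin
        dot³ v v ℤ.+ ℤ.- (+ c) ≡⟨ cong (ℤ._+ ℤ.- (+ c)) v·v≡t ⟩
        + t ℤ.+ ℤ.- (+ c) ≡⟨ cong (ℤ._+ ℤ.- (+ c)) (trans (ℤ.pos-+ (7 ℕ.* n) c) (cong (ℤ._+ + c) (ℤ.pos-* 7 n))) ⟩
        + 7 ℤ.* + n ℤ.+ + c ℤ.+ ℤ.- (+ c) ≡⟨ solve 2 (λ n c → con (+ 7) :* n :+ c :+ :- c := n :* con (+ 7)) refl (+ n) (+ c) ⟩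
        + n ℤ.* + 7 ∎)))
    where
    open ≡-Reasoning
    t = 7 ℕ.* n ℕ.+ c

-- The congruences for pbar3.

open import Data.List using (length)
open import Data.List.Membership.Propositional using (_∈_)
open import Data.List.Relation.Unary.Any using (here; there)
open import Data.Nat
open import Data.Nat.Properties
open import Data.Nat.Solver using (module +-*-Solver)
open import Data.Product using (_×_; _,_)
open import Relation.Binary.PropositionalEquality
open PowerSeries
open Overpartitions
open Quaternions

pbar3-7n≡r₃ : ∀ {M n} → n ≤ M → pbar3 (7 * n) ≡₇ 6 ^ n * length (sphere³ (7 * M) n)
pbar3-7n≡r₃ {M} {n} n≤M = pbar3-7n M (λ m m≤M → sphere⁴-7n m (*-monoʳ-≤ 7 m≤M)) n n≤M

-- The residue class of t gives the vanishing at 49t. From there on the argument is divisible by 7,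
-- so each further factor 49 leaves the count unchanged modulo 7.
sphere³-49^1+a : ∀ {N} n {c} → c ∈ residues → ∀ a → 49 ^ suc a * (7 * n + c) ≤ N →
                 length (sphere³ N (49 ^ suc a * (7 * n + c))) ≡₇ 0
sphere³-49^1+a n c∈ zero ≤N = sphere³-49[7n+c] n c∈ ≤N
sphere³-49^1+a {N} n {c} c∈ (suc a) ≤N = begin
  length (sphere³ N (49 ^ suc (suc a) * t)) % 7
    ≡⟨ cong (λ m → length (sphere³ N m) % 7) 49^≡ ⟩
  length (sphere³ N (49 * (7 * j))) % 7
    ≡⟨ sphere³-49·7n j (≤-trans (≤-reflexive (sym 49^≡)) ≤N) ⟩
  length (sphere³ N (7 * j)) % 7
    ≡⟨ cong (λ m → length (sphere³ N m) % 7) 7j≡ ⟩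
  length (sphere³ N (49 ^ suc a * t)) % 7
    ≡⟨ sphere³-49^1+a n c∈ a (≤-trans (m≤n*m _ 49) (≤-trans (≤-reflexive (sym (*-assoc 49 (49 ^ suc a) t))) ≤N)) ⟩
  0 ∎
  where
  open ≡-Reasoning
  t = 7 * n + c
  j = 7 * (49 ^ a * t)
  7j≡ : 7 * j ≡ 49 ^ suc a * t
  7j≡ = solve 2 (λ p t → con 7 :* (con 7 :* (p :* t)) := con 49 :* p :* t) refl (49 ^ a) t
    where open +-*-Solver
  49^≡ : 49 ^ suc (suc a) * t ≡ 49 * (7 * j)
  49^≡ = trans (*-assoc 49 (49 ^ suc a) t) (cong (49 *_) (sym 7j≡))

theorem4p5 : (∀ (n : ℕ) → pbar3 (7 ^ 4 * n) % 7 ≡ pbar3 (7 ^ 2 * n) % 7)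
    × (∀ (n α : ℕ) → 1 ≤ α →
    (pbar3 (7 ^ (2 * α + 1) * (7 * n + 3)) % 7 ≡ 0)
    × (pbar3 (7 ^ (2 * α + 1) * (7 * n + 5)) % 7 ≡ 0)
    × (pbar3 (7 ^ (2 * α + 1) * (7 * n + 6)) % 7 ≡ 0))
theorem4p5 = part₁ , λ { n (suc a) _ →
  part₂ n (here refl) a , part₂ n (there (here refl)) a , part₂ n (there (there (here refl))) a }
  where
  open ≡-Reasoning

  part₁ : ∀ n → pbar3 (7 ^ 4 * n) ≡₇ pbar3 (7 ^ 2 * n)
  part₁ n = begin
    pbar3 (7 ^ 4 * n) % 7
      ≡⟨ cong (λ m → pbar3 m % 7) (*-assoc 7 343 n) ⟩
    pbar3 (7 * M) % 7
      ≡⟨ pbar3-7n≡r₃ {M} ≤-refl ⟩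
    6 ^ M * length (sphere³ N M) % 7
      ≡⟨ *-cong-≡₇ {6 ^ M} {6 ^ (7 * n)} sign sphere ⟩
    6 ^ (7 * n) * length (sphere³ N (7 * n)) % 7
      -- The bound M = 343n is kept for the argument 7n, so that both spheres lie in the same box;
      -- 336 = 343 - 7.
      ≡⟨ pbar3-7n≡r₃ {M} (*-monoˡ-≤ n {7} {343} (m≤m+n 7 336)) ⟨
    pbar3 (7 * (7 * n)) % 7
      ≡⟨ cong (λ m → pbar3 m % 7) (*-assoc 7 7 n) ⟨
    pbar3 (7 ^ 2 * n) % 7 ∎
    where
    M = 343 * n
    N = 7 * M

    -- 343n = 7 · 7 · 7n, and Fermat removes two factors 7 from the exponent.
    sign : 6 ^ M ≡₇ 6 ^ (7 * n)
    sign = trans (cong (λ m → 6 ^ m % 7) (trans (*-assoc 7 49 n) (cong (7 *_) (*-assoc 7 7 n))))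
      (trans (6^7n≡6^n (7 * (7 * n))) (6^7n≡6^n (7 * n)))

    M≡ : M ≡ 49 * (7 * n)
    M≡ = *-assoc 49 7 n

    sphere : length (sphere³ N M) ≡₇ length (sphere³ N (7 * n))
    sphere = trans (cong (λ m → length (sphere³ N m) % 7) M≡)
      (sphere³-49·7n n (≤-trans (≤-reflexive (sym M≡)) (m≤n*m M 7)))

  part₂ : ∀ n {c} → c ∈ residues → ∀ a → pbar3 (7 ^ (2 * suc a + 1) * (7 * n + c)) ≡₇ 0
  part₂ n {c} c∈ a = begin
    pbar3 (7 ^ (2 * suc a + 1) * t) % 7
      ≡⟨ cong (λ m → pbar3 m % 7) (trans (cong (_* t) 7^≡) (*-assoc 7 (49 ^ suc a) t)) ⟩
    pbar3 (7 * M) % 7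
      ≡⟨ pbar3-7n≡r₃ {M} ≤-refl ⟩
    6 ^ M * length (sphere³ (7 * M) M) % 7
      ≡⟨ *-cong-≡₇ {6 ^ M} {6 ^ M} {length (sphere³ (7 * M) M)} {0} refl (sphere³-49^1+a n c∈ a (m≤n*m M 7)) ⟩
    6 ^ M * 0 % 7
      ≡⟨ cong (_% 7) (*-zeroʳ (6 ^ M)) ⟩
    0 ∎
    where
    t = 7 * n + c
    M = 49 ^ suc a * t

    7^≡ : 7 ^ (2 * suc a + 1) ≡ 7 * 49 ^ suc a
    7^≡ = trans (cong (7 ^_) (+-comm (2 * suc a) 1)) (cong (7 *_) (sym (^-*-assoc 7 2 (suc a))))
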